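{- Let $\alpha$ be a composition of $n>0$. The map $\varphi$, sending $w\in\mathfrak{S}_\alpha(231)$ to the northeast path $\varphi(w)=[f_0,f_1,\dots,f_n]$ with $$f_i=\bigl|\{j\mid 1\le j\le n,\ \mathrm{code}_\alpha(w)_j+s_{\varrho(j)}=i\}\bigr|\qquad(0\le i\le n),$$ is an isomorphism (of posets) from the $\alpha$-Tamari lattice $\mathcal{T}_\alpha$ to the $\nu_\alpha$-Tamari lattice $\mathcal{T}_{\nu_\alpha}$.
   Context: Let $n>0$, $[n]=\{1,\dots,n\}$, and let $\alpha=(\alpha_1,\dots,\alpha_r)$ be a composition of $n$ (positive integers summing to $n$). Put $s_0=0$ and $s_a=\alpha_1+\cdots+\alpha_a$ for $a\in[r]$. The $a$-th $\alpha$-region is $\{s_{a-1}+1,\dots,s_a\}$, and $\varrho(i)$ denotes the index of the region containing $i$. $\mathfrak{S}_\alpha=\{w\in\mathfrak{S}_n\mid w(i)<w(i+1)\text{ whenever }\varrho(i)=\varrho(i+1)\}$; write $w_i=w(i)$. An element $w\in\mathfrak{S}_\alpha$ has an $(\alpha,231)$-pattern if there are indices $i<j<k$, each in a different $\alpha$-region, with $w_i<w_j$ and $w_i=w_k+1$. $\mathfrak{S}_\alpha(231)$ is the set of $w\in\mathfrak{S}_\alpha$ having no such pattern. With $\mathrm{Inv}(w)=\{(i,j)\mid i<j,\ w_i>w_j\}$, the weak order is $u\leq_L v\iff\mathrm{Inv}(u)\subseteq\mathrm{Inv}(v)$, and $\mathcal{T}_\alpha=(\mathfrak{S}_\alpha(231),\leq_L)$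 (known to be a lattice). For $w\in\mathfrak{S}_\alpha$, $\mathrm{code}_\alpha(w)=(c_1,\dots,c_n)$ where $c_i$ is the largest $k\ge 0$ (with $s_{\varrho(i)}+k\le n$) such that $w_i>w_{s_{\varrho(i)}+1},\ w_i>w_{s_{\varrho(i)}+2},\dots,\ w_i>w_{s_{\varrho(i)}+k}$. A northeast path is a lattice path (starting on the $x$-axis, say at the origin) made of north steps $N=(0,1)$ and east steps $E=(1,0)$. Write $[a_0,a_1,\dots,a_k]$ for the path $E^{a_0}NE^{a_1}N\cdots NE^{a_k}$. The $\alpha$-bounce path is $\nu_\alpha=N^{\alpha_1}E^{\alpha_1}N^{\alpha_2}E^{\alpha_2}\cdots N^{\alpha_r}E^{\alpha_r}$. For a northeast path $\nu$, $\mathcal{L}_\nu$ is the set of northeast paths with the same starting and ending points as $\nu$ that never go below $\nu$. For a lattice point $Q$ on $\mu\in\mathcal{L}_\nu$, $\mathrm{horiz}_\nu(Q)$ is the largest number of east steps that can be added to $Q$ without crossing to the other side of $\nu$ (i.e. the $x$-coordinate of the rightmost point of $\nu$ at the height of $Q$, minus the $x$-coordinate of $Q$). A valley of $\mu$ is a lattice point $V$ on $\mu$ preceded by an east step and followed by a north step. The rotation of $\mu$ by a valley $V$ is the path $\mu'\in\mathcal{L}_\nu$ obtained by exchanging the east step before $V$ with the portion of $\mu$ between $V$ and the next lattice point $W$ on $\mu$ after $V$ with $\mathrm{horiz}_\nu(W)=\mathrm{horiz}_\nu(V)$; then $\mu$ is placed below $\mu'$. The reflexive and transitive closure is a partial order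 on $\mathcal{L}_\nu$, and the resulting poset is the $\nu$-Tamari lattice $\mathcal{T}_\nu$. -}

module Defs where

open import Level using (0ℓ)
open import Data.Empty using (⊥-elim)
open import Data.Nat using (ℕ; zero; suc; _+_; _∸_; _≤_; _<_; z≤n; s≤s; _≤?_; _<?_; _≟_)
open import Data.Nat.Properties as ℕₚ
  using (≤-refl; ≤-trans; ≤-antisym; <-trans; <-irrefl; ≰⇒>; m≤m+n;
         +-comm; +-assoc; +-monoʳ-≤; +-monoʳ-<; m+[n∸m]≡n)
open import Data.Fin using (Fin; toℕ; fromℕ<) renaming (_<_ to _<ᶠ_; _>_ to _>ᶠ_)
open import Data.Fin.Properties as Finₚ
  using (all?; toℕ-fromℕ<; toℕ<n; toℕ-injective; <-cmp)
open import Data.Fin.Permutation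
  using (Permutation′; _⟨$⟩ʳ_; _⟨$⟩ˡ_; inverseˡ; inverseʳ)
open import Data.List using (List; []; _∷_; _++_; length; filter; take; replicate; concatMap; allFin)
open import Data.Nat.ListAction using (sum)
open import Data.List.Relation.Unary.All using (All)
open import Data.Vec using (Vec; []; _∷_; tabulate)
open import Data.Product using (Σ; ∃; ∃₂; _×_; _,_; proj₁; proj₂; map₁; map₂)
open import Function using (_on_)
open import Relation.Binary.Bundles using (Poset)
open import Relation.Binary.Definitions using (tri<; tri≈; tri>)
open import Relation.Binary.Construct.Closure.ReflexiveTransitive using (Star; ε; _◅_; _◅◅_)
open import Relation.Binary.Morphism.Structures using (IsOrderIsomorphism)
open import Relation.Binary.PropositionalEquality
  using (_≡_; _≢_; refl; sym; trans; cong; subst; subst₂)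
open import Relation.Nullary using (¬_; yes; no)
open import Relation.Nullary.Decidable using (_×-dec_; _→-dec_)
open import Relation.Unary using (Pred; Decidable; _⊆_)

------------------------------------------------------------------------
-- Compositions and regions

record Composition (n : ℕ) : Set where
  field
    parts    : List ℕ
    positive : All (0 <_) parts
    sums     : sum parts ≡ n

open Composition public

-- `i : Fin n` stands for the element `pos i` of {1,…,n}.
pos : ∀ {n} → Fin n → ℕ
pos i = suc (toℕ i)

partialSum : List ℕ → ℕ → ℕ
partialSum as a = sum (take a as)

-- 1-based index of the block containing the 1-based position i;
-- the value at [] is never used for positions in range.
regionOf : List ℕ → ℕ → ℕ
regionOf []       i = 0
regionOf (a ∷ as) i with i ≤? a
... | yes _ = 1
... | no  _ = suc (regionOf as (i ∸ a))

module _ {n : ℕ} (α : Composition n) where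

  s : ℕ → ℕ
  s = partialSum (parts α)

  ϱ : Fin n → ℕ
  ϱ i = regionOf (parts α) (pos i)

regionOf-spec : ∀ as i → 0 < i → i ≤ sum as →
                partialSum as (regionOf as i ∸ 1) < i × i ≤ partialSum as (regionOf as i)
regionOf-spec []       i 0<i i≤ = ⊥-elim (<-irrefl refl (≤-trans 0<i i≤))
regionOf-spec (a ∷ as) i 0<i i≤ with i ≤? a
... | yes i≤a = 0<i , ≤-trans i≤a (m≤m+n a 0)
... | no  i≰a = go (regionOf as (i ∸ a)) refl
  where
  a≤i : a ≤ i
  a≤i = ℕₚ.<⇒≤ (≰⇒> i≰a)
  eq : a + (i ∸ a) ≡ i
  eq = m+[n∸m]≡n a≤i
  ih : partialSum as (regionOf as (i ∸ a) ∸ 1) < i ∸ a × i ∸ a ≤ partialSum as (regionOf as (i ∸ a))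
  ih = regionOf-spec as (i ∸ a) (ℕₚ.m<n⇒0<n∸m (≰⇒> i≰a))
         (ℕₚ.+-cancelˡ-≤ a _ _ (subst (_≤ a + sum as) (sym eq) i≤))
  up : i ≤ a + partialSum as (regionOf as (i ∸ a))
  up = subst (_≤ a + partialSum as (regionOf as (i ∸ a))) eq (+-monoʳ-≤ a (proj₂ ih))
  go : ∀ k → regionOf as (i ∸ a) ≡ k → partialSum (a ∷ as) k < i × i ≤ a + partialSum as (regionOf as (i ∸ a))
  go zero    _ = 0<i , up
  go (suc k) e = subst (a + partialSum as k <_) eq
                   (+-monoʳ-< a (subst (λ z → partialSum as (z ∸ 1) < i ∸ a) e (proj₁ ih))) , up

------------------------------------------------------------------------
-- The α-Tamari lattice

module _ {n : ℕ} (α : Composition n) where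

  record 𝔖 : Set where
    field
      perm       : Permutation′ n
      increasing : ∀ i j → pos j ≡ suc (pos i) → ϱ α i ≡ ϱ α j →
                   (perm ⟨$⟩ʳ i) <ᶠ (perm ⟨$⟩ʳ j)

  open 𝔖 public

_at_ : ∀ {n} {α : Composition n} → 𝔖 α → Fin n → Fin n
w at i = perm w ⟨$⟩ʳ i

module _ {n : ℕ} {α : Composition n} where

  record Pattern231 (w : 𝔖 α) : Set where
    field
      i j k : Fin n
      i<j   : i <ᶠ j
      j<k   : j <ᶠ k
      ϱi≢ϱj : ϱ α i ≢ ϱ α j
      ϱj≢ϱk : ϱ α j ≢ ϱ α k
      ϱi≢ϱk : ϱ α i ≢ ϱ α k
      wi<wj : (w at i) <ᶠ (w at j)
      wi≡wk+1 : toℕ (w at i) ≡ suc (toℕ (w at k))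

  Inv : 𝔖 α → Pred (Fin n × Fin n) 0ℓ
  Inv w (i , j) = i <ᶠ j × (w at i) >ᶠ (w at j)

  infix 4 _≤L_
  _≤L_ : 𝔖 α → 𝔖 α → Set
  u ≤L v = Inv u ⊆ Inv v

𝔖231 : ∀ {n} → Composition n → Set
𝔖231 α = Σ (𝔖 α) λ w → ¬ Pattern231 w

private
  StrictMono : ∀ {n} → (Fin n → Fin n) → Set
  StrictMono f = ∀ {a b} → a <ᶠ b → f a <ᶠ f b

  inflationary : ∀ {n} (f : Fin n → Fin n) → StrictMono f →
                 ∀ m i → toℕ i ≡ m → m ≤ toℕ (f i)
  inflationary f mono zero    i _  = z≤n
  inflationary {n} f mono (suc m) i eq =
    ≤-trans (s≤s (inflationary f mono m j (toℕ-fromℕ< m<n))) (mono j<i)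
    where
    m<n : m < n
    m<n = <-trans (≤-refl {suc m}) (subst (_< n) eq (toℕ<n i))
    j : Fin n
    j = fromℕ< m<n
    j<i : j <ᶠ i
    j<i = subst₂ _<_ (sym (toℕ-fromℕ< m<n)) (sym eq) (≤-refl {suc m})

  at-injective : ∀ {n} {α : Composition n} (w : 𝔖 α) {i j} → w at i ≡ w at j → i ≡ j
  at-injective w {i} {j} e =
    trans (sym (inverseˡ (perm w))) (trans (cong (perm w ⟨$⟩ˡ_) e) (inverseˡ (perm w)))

  ≤L-pointwise : ∀ {n} {α : Composition n} (u v : 𝔖 α) → u ≤L v → v ≤L u →
                 ∀ i → toℕ (u at i) ≤ toℕ (v at i)
  ≤L-pointwise {n} u v u≤v v≤u i =
    subst (λ z → toℕ (u at i) ≤ toℕ (v at z)) (inverseˡ (perm u))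
      (inflationary σ mono _ (u at i) refl)
    where
    σ : Fin n → Fin n
    σ a = v at (perm u ⟨$⟩ˡ a)
    mono : StrictMono σ
    mono {a} {b} a<b with <-cmp (perm u ⟨$⟩ˡ a) (perm u ⟨$⟩ˡ b)
    ... | tri> _ _ j<i = proj₂ (u≤v (j<i ,
            subst₂ _<ᶠ_ (sym (inverseʳ (perm u))) (sym (inverseʳ (perm u))) a<b))
    ... | tri≈ _ i≡j _ = ⊥-elim (<-irrefl (cong toℕ
            (trans (sym (inverseʳ (perm u))) (trans (cong (perm u ⟨$⟩ʳ_) i≡j) (inverseʳ (perm u))))) a<b)
    ... | tri< i<j i≢j _ with <-cmp (σ a) (σ b)
    ...   | tri< lt _ _ = lt
    ...   | tri≈ _ e _  = ⊥-elim (i≢j (at-injective v e))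
    ...   | tri> _ _ gt = ⊥-elim (ℕₚ.<-asym a<b (subst₂ _<ᶠ_ (inverseʳ (perm u)) (inverseʳ (perm u))
                            (proj₂ (v≤u (i<j , gt)))))

  ≤L-reflexive : ∀ {n} {α : Composition n} (u v : 𝔖 α) → (∀ i → u at i ≡ v at i) → u ≤L v
  ≤L-reflexive u v u≈v (i<j , gt) = i<j , subst₂ _<ᶠ_ (u≈v _) (u≈v _) gt

-- Permutations are compared pointwise.
𝒯 : ∀ {n} → Composition n → Poset 0ℓ 0ℓ 0ℓ
𝒯 α = record
  { Carrier = 𝔖231 α
  ; _≈_ = λ u v → ∀ i → proj₁ u at i ≡ proj₁ v at i
  ; _≤_ = _≤L_ on proj₁
  ; isPartialOrder = record
    { isPreorder = record
      { isEquivalence = record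
        { refl  = λ i → refl
        ; sym   = λ e i → sym (e i)
        ; trans = λ e f i → trans (e i) (f i)
        }
      ; reflexive = λ {u} {v} → ≤L-reflexive (proj₁ u) (proj₁ v)
      ; trans = λ u≤v v≤w x → v≤w (u≤v x)
      }
    ; antisym = λ {u} {v} u≤v v≤u i → toℕ-injective
        (≤-antisym (≤L-pointwise (proj₁ u) (proj₁ v) u≤v v≤u i)
                   (≤L-pointwise (proj₁ v) (proj₁ u) v≤u u≤v i))
    }
  }

------------------------------------------------------------------------
-- Codes

-- Largest k ≤ m satisfying P; it is 0 if there is none.
largest : ∀ {P : Pred ℕ 0ℓ} → Decidable P → ℕ → ℕ
largest P? zero    = 0
largest P? (suc m) with P? (suc m)
... | yes _ = suc m
... | no  _ = largest P? m

module _ {n : ℕ} {α : Composition n} (w : 𝔖 α) where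

  DominatesNext : Fin n → Pred ℕ 0ℓ
  DominatesNext i k =
    s α (ϱ α i) + k ≤ n ×
    (∀ j → s α (ϱ α i) < pos j → pos j ≤ s α (ϱ α i) + k → (w at i) >ᶠ (w at j))

  dominatesNext? : ∀ i → Decidable (DominatesNext i)
  dominatesNext? i k =
    (s α (ϱ α i) + k ≤? n) ×-dec
    all? (λ j → (s α (ϱ α i) <? pos j) →-dec
                ((pos j ≤? s α (ϱ α i) + k) →-dec (w at j Finₚ.<? w at i)))

  code : Fin n → ℕ
  code i = largest (dominatesNext? i) n

------------------------------------------------------------------------
-- Northeast paths, starting at the origin

data Step : Set where
  N E : Step

Path : Set
Path = List Step

Point : Set
Point = ℕ × ℕ

endpoint : Path → Point
endpoint []      = 0 , 0
endpoint (E ∷ p) = map₁ suc (endpoint p)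
endpoint (N ∷ p) = map₂ suc (endpoint p)

infix 4 _On_
_On_ : Point → Path → Set
P On μ = ∃₂ λ p q → μ ≡ p ++ q × endpoint p ≡ P

-- [a₀,a₁,…,a_k]
bracket : ∀ {k} → Vec ℕ (suc k) → Path
bracket (a ∷ [])     = replicate a E
bracket (a ∷ b ∷ as) = replicate a E ++ N ∷ bracket (b ∷ as)

bouncePath : ∀ {n} → Composition n → Path
bouncePath α = concatMap (λ a → replicate a N ++ replicate a E) (parts α)

record _∈𝓛_ (μ ν : Path) : Set where
  field
    sameEnd    : endpoint μ ≡ endpoint ν
    neverBelow : ∀ {x y} → (x , y) On μ → ∃ λ y′ → (x , y′) On ν × y′ ≤ y

𝓛 : Path → Set
𝓛 ν = Σ Path (_∈𝓛 ν)

------------------------------------------------------------------------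
-- The ν-Tamari lattice

-- x-coordinate of the rightmost point of ν at height y,
-- meaningful when y is at most the height of the endpoint of ν.
rightmost : Path → ℕ → ℕ
rightmost []      y       = 0
rightmost (E ∷ ν) y       = suc (rightmost ν y)
rightmost (N ∷ ν) zero    = 0
rightmost (N ∷ ν) (suc y) = rightmost ν y

rightmost-on : ∀ ν y → y ≤ proj₂ (endpoint ν) → (rightmost ν y , y) On ν
rightmost-on []      zero    _ = [] , [] , refl , refl
rightmost-on (E ∷ ν) y       y≤ with rightmost-on ν y y≤
... | p , q , eq , e = E ∷ p , q , cong (E ∷_) eq , cong (map₁ suc) e
rightmost-on (N ∷ ν) zero    _ = [] , N ∷ ν , refl , refl
rightmost-on (N ∷ ν) (suc y) (s≤s y≤) with rightmost-on ν y y≤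
... | p , q , eq , e = N ∷ p , q , cong (N ∷_) eq , cong (map₂ suc) e

rightmost-max : ∀ ν {x y} → (x , y) On ν → x ≤ rightmost ν y
rightmost-max ν       ([]    , q , _ , refl)    = z≤n
rightmost-max (E ∷ ν) (E ∷ p , q , refl , refl) = s≤s (rightmost-max ν (p , q , refl , refl))
rightmost-max (N ∷ ν) (N ∷ p , q , refl , refl) = rightmost-max ν (p , q , refl , refl)

-- The subtraction does not truncate at points of a path in 𝓛 ν.
horiz : Path → Point → ℕ
horiz ν (x , y) = rightmost ν y ∸ x

-- μ consists of p, then E, then N q, then r.  The valley V is the endpoint
-- of p E, and W is the endpoint of p E N q.
record Rotation (ν μ μ′ : Path) : Set where
  field
    μ∈𝓛    : μ ∈𝓛 ν
    μ′∈𝓛   : μ′ ∈𝓛 ν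
    p q r  : Path
    before : μ  ≡ p ++ E ∷ N ∷ q ++ r
    after  : μ′ ≡ p ++ N ∷ q ++ E ∷ r
    horizW : horiz ν (endpoint (p ++ E ∷ N ∷ q)) ≡ horiz ν (endpoint (p ++ E ∷ []))
    next   : ∀ q₁ q₂ → q ≡ q₁ ++ q₂ → q₂ ≢ [] →
             horiz ν (endpoint (p ++ E ∷ N ∷ q₁)) ≢ horiz ν (endpoint (p ++ E ∷ []))

infix 4 _⊢_≤ᵣ_
_⊢_≤ᵣ_ : (ν : Path) → Path → Path → Set
ν ⊢ μ ≤ᵣ μ′ = Star (Rotation ν) μ μ′

private
  #N : Path → ℕ
  #N []      = 0
  #N (E ∷ p) = #N p
  #N (N ∷ p) = suc (#N p)

  area : Path → ℕ
  area []      = 0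
  area (E ∷ p) = #N p + area p
  area (N ∷ p) = area p

  #N-++ : ∀ p q → #N (p ++ q) ≡ #N p + #N q
  #N-++ []      q = refl
  #N-++ (E ∷ p) q = #N-++ p q
  #N-++ (N ∷ p) q = cong suc (#N-++ p q)

  area-slide : ∀ q r → area (q ++ E ∷ r) ≡ #N r + area (q ++ r)
  area-slide []      r = refl
  area-slide (N ∷ q) r = area-slide q r
  area-slide (E ∷ q) r
    rewrite area-slide q r | #N-++ q (E ∷ r) | #N-++ q r
          | sym (+-assoc (#N q + #N r) (#N r) (area (q ++ r)))
          | +-comm (#N q + #N r) (#N r)
          | +-assoc (#N r) (#N q + #N r) (area (q ++ r)) = refl

  area-prefix : ∀ p x y → #N x ≡ #N y → area x < area y → area (p ++ x) < area (p ++ y)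
  area-prefix []      x y e lt = lt
  area-prefix (N ∷ p) x y e lt = area-prefix p x y e lt
  area-prefix (E ∷ p) x y e lt
    rewrite #N-++ p x | #N-++ p y | e = +-monoʳ-< (#N p + #N y) (area-prefix p x y e lt)

  rotation-area : ∀ {ν μ μ′} → Rotation ν μ μ′ → area μ′ < area μ
  rotation-area R =
    subst₂ (λ a b → area a < area b) (sym after) (sym before)
      (area-prefix p (N ∷ q ++ E ∷ r) (E ∷ N ∷ q ++ r)
        (cong suc (trans (#N-++ q (E ∷ r)) (sym (#N-++ q r)))) lt)
    where
    open Rotation R
    lt : area (q ++ E ∷ r) < suc (#N (q ++ r)) + area (q ++ r)
    lt rewrite area-slide q r | #N-++ q r =
      s≤s (ℕₚ.+-monoˡ-≤ (area (q ++ r)) (ℕₚ.m≤n+m (#N r) (#N q)))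

  star-area : ∀ {ν μ μ′} → ν ⊢ μ ≤ᵣ μ′ → area μ′ ≤ area μ
  star-area ε        = ≤-refl
  star-area (R ◅ Rs) = ≤-trans (star-area Rs) (ℕₚ.<⇒≤ (rotation-area R))

  ≤ᵣ-antisym : ∀ {ν μ μ′} → ν ⊢ μ ≤ᵣ μ′ → ν ⊢ μ′ ≤ᵣ μ → μ ≡ μ′
  ≤ᵣ-antisym ε        _  = refl
  ≤ᵣ-antisym (R ◅ Rs) Ss =
    ⊥-elim (<-irrefl refl (≤-trans (rotation-area R) (≤-trans (star-area Ss) (star-area Rs))))

  ≡⇒≤ᵣ : ∀ {ν μ μ′} → μ ≡ μ′ → ν ⊢ μ ≤ᵣ μ′
  ≡⇒≤ᵣ refl = ε

-- Elements of 𝓛 ν are compared as paths, ignoring membership proofs.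
𝒯ν : Path → Poset 0ℓ 0ℓ 0ℓ
𝒯ν ν = record
  { Carrier = 𝓛 ν
  ; _≈_ = _≡_ on proj₁
  ; _≤_ = (ν ⊢_≤ᵣ_) on proj₁
  ; isPartialOrder = record
    { isPreorder = record
      { isEquivalence = record { refl = refl ; sym = sym ; trans = trans }
      ; reflexive = ≡⇒≤ᵣ
      ; trans = _◅◅_
      }
    ; antisym = ≤ᵣ-antisym
    }
  }

------------------------------------------------------------------------
-- The map φ

module _ {n : ℕ} {α : Composition n} (w : 𝔖 α) where

  f : ℕ → ℕ
  f i = length (filter (λ j → code w j + s α (ϱ α j) ≟ i) (allFin n))

  φ : Path
  φ = bracket (tabulate {n = suc n} λ i → f (toℕ i))

IsPosetIsomorphism : (P Q : Poset 0ℓ 0ℓ 0ℓ) → (Poset.Carrier P → Poset.Carrier Q) → Set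
IsPosetIsomorphism P Q = IsOrderIsomorphism P._≈_ Q._≈_ P._≤_ Q._≤_
  where
  module P = Poset P
  module Q = Poset Q

{-# OPTIONS --safe #-}
module Submission where

-- Give each position i the height h i = s_ϱ(i), the end of its region, and let
-- t i = code_i + h i.  Read a northeast path with a stack: on reaching height y, push the
-- positions of height y (smallest on top); an east step at height y pops a position j and
-- records b j = y.  The stack size is horiz, so a rotation keeps every recorded value except
-- that of the east step moved, which increases.  The vectors recorded by the paths above
-- ν_α are exactly those satisfying IsCode; φ(w) records t, and rotation order becomes the
-- componentwise order.  On the side of permutations, the inversions of a pattern-avoiding w
-- are the transitive closure of the pairs (i , j) with h i < j ≤ t i, which turns the weak
-- order into the same componentwise order and recovers w from t.

open import Defs
open import Data.Nat using (ℕ; _<_)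
open import Data.Product using (Σ; _×_; proj₁)
open import Relation.Binary.PropositionalEquality using (_≡_)
open import Data.Empty using (⊥; ⊥-elim)
open import Data.Fin using (Fin; toℕ; fromℕ<; punchOut; _↑ˡ_; _↑ʳ_) renaming (_<_ to _<ᶠ_)
open import Data.Fin.Permutation
  using (Permutation′; permutation; _⟨$⟩ʳ_; _⟨$⟩ˡ_; inverseˡ; inverseʳ)
open import Data.Fin.Properties as Finₚ
  using (toℕ<n; toℕ-injective; toℕ-fromℕ<; any?; punchOut-injective; injective⇒≤)
open import Data.List as List
  using (List; []; _∷_; _++_; length; filter; map; concatMap; replicate; allFin)
open import Data.List.Membership.Propositional using (_∈_)
open import Data.List.Membership.Propositional.Properties
  using (∈-++⁺ˡ; ∈-++⁺ʳ; ∈-++⁻; ∈-filter⁺; ∈-filter⁻; ∈-allFin)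
open import Data.List.Properties
  using (length-++; ++-assoc; ++-identityʳ; ∷-injective; length-tabulate; map-tabulate;
         filter-all; filter-none; filter-accept; filter-reject; filter-++; filter-≐)
open import Data.List.Relation.Binary.Permutation.Propositional
  using (_↭_; prep; ↭-refl; ↭-trans; ↭-sym)
open import Data.List.Relation.Binary.Permutation.Propositional.Properties
  using (shift; ↭-length; filter-↭)
open import Data.List.Relation.Unary.All as All using (All; []; _∷_)
import Data.List.Relation.Unary.All.Properties as Allₚ
open import Data.List.Relation.Unary.AllPairs using (AllPairs; []; _∷_)
import Data.List.Relation.Unary.AllPairs.Properties as AllPairsₚ
open import Data.List.Relation.Unary.Any using (here; there)
open import Data.Nat
  using (zero; suc; _+_; _∸_; _≤_; z≤n; s≤s; _≟_; _≤?_; _<?_)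
open import Data.Nat.ListAction using (sum)
open import Data.Nat.Properties
open import Data.Product using (∃; ∃-syntax; _,_; proj₂; map₁; map₂)
open import Data.Sum as Sum using (_⊎_; inj₁; inj₂; [_,_]′)
open import Data.Vec using (tabulate)
open import Function using (_∘_; id)
open import Relation.Binary.Bundles using (Poset)
open import Relation.Binary.Construct.Closure.ReflexiveTransitive using (ε; _◅_)
open import Relation.Binary.Definitions using (tri<; tri≈; tri>)
open import Relation.Binary.PropositionalEquality
  using (_≢_; refl; sym; trans; cong; cong₂; subst; subst₂; module ≡-Reasoning)
open import Relation.Nullary using (¬_; Dec; yes; no)
open import Relation.Nullary.Decidable using (map′; _×-dec_; _⊎-dec_; ¬?)
open import Relation.Unary using (Decidable)

-- Lists and finite sums

-- Two implications do not follow formally from these descriptions. For rotations, if `b ≤ b′`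
-- componentwise, some valley must be rotated without overshooting `b′`. The condition `across`
-- provides this: everything popped between the valley and the point W is bounded by the target
-- value of the moved position, so W lies no higher than that value. For permutations, a code vector
-- must be turned into a permutation. The closure of the covering pairs is transitive by
-- construction; its complement among increasing pairs is transitive as well, by `within` and
-- because regions are intervals, and together these make it an inversion set. The requirement that
-- the pattern uses consecutive values fits chains: a chain with an intermediate position puts a
-- value strictly between those of its ends, so a pattern could only come from a single covering
-- pair.

AllPairs-map∈ : ∀ {A : Set} {R S : A → A → Set} {xs} →
                (∀ {x y} → x ∈ xs → y ∈ xs → R x y → S x y) → AllPairs R xs → AllPairs S xs
AllPairs-map∈ g []       = []
AllPairs-map∈ g (r ∷ rs) =
  All.tabulate (λ y∈ → g (here refl) (there y∈) (All.lookup r y∈)) ∷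
  AllPairs-map∈ (λ x∈ y∈ → g (there x∈) (there y∈)) rs

AllPairs-++ʳ : ∀ {A : Set} {R : A → A → Set} xs {ys} → AllPairs R (xs ++ ys) → AllPairs R ys
AllPairs-++ʳ []       ps       = ps
AllPairs-++ʳ (x ∷ xs) (_ ∷ ps) = AllPairs-++ʳ xs ps

AllPairs-++ˡ : ∀ {A : Set} {R : A → A → Set} xs {ys} → AllPairs R (xs ++ ys) → AllPairs R xs
AllPairs-++ˡ []       ps       = []
AllPairs-++ˡ (x ∷ xs) (p ∷ ps) = Allₚ.++⁻ˡ xs p ∷ AllPairs-++ˡ xs ps

AllPairs-cross : ∀ {A : Set} {R : A → A → Set} {xs ys x y} →
                 AllPairs R (xs ++ ys) → x ∈ xs → y ∈ ys → R x y
AllPairs-cross {xs = _ ∷ xs} (p ∷ _)  (here refl) y∈ = All.lookup p (∈-++⁺ʳ xs y∈)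
AllPairs-cross {xs = _ ∷ _}  (_ ∷ ps) (there x∈)  y∈ = AllPairs-cross ps x∈ y∈

filter-⊎ : ∀ {A : Set} {P Q R : A → Set} (P? : Decidable P) (Q? : Decidable Q) (R? : Decidable R) →
           (∀ {x} → P x → Q x ⊎ R x) → (∀ {x} → Q x → P x) → (∀ {x} → R x → P x) →
           (∀ {x} → Q x → ¬ R x) → ∀ xs → filter P? xs ↭ filter Q? xs ++ filter R? xs
filter-⊎ P? Q? R? PQR QP RP QR [] = ↭-refl
filter-⊎ P? Q? R? PQR QP RP QR (x ∷ xs) with ih ← filter-⊎ P? Q? R? PQR QP RP QR xs | Q? x | R? x
... | yes q | yes r = ⊥-elim (QR q r)
... | yes q | no ¬r rewrite filter-accept P? {x} {xs} (QP q) = prep x ih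
... | no ¬q | yes r rewrite filter-accept P? {x} {xs} (RP r) =
  ↭-trans (prep x ih) (↭-sym (shift x (filter Q? xs) (filter R? xs)))
... | no ¬q | no ¬r rewrite filter-reject P? {x} {xs} (λ p → [ ¬q , ¬r ]′ (PQR p)) = ih

sum-map-≤ : ∀ {A : Set} {u v : A → ℕ} (xs : List A) → (∀ x → u x ≤ v x) → sum (map u xs) ≤ sum (map v xs)
sum-map-≤ []       u≤v = z≤n
sum-map-≤ (x ∷ xs) u≤v = +-mono-≤ (u≤v x) (sum-map-≤ xs u≤v)

sum-map-< : ∀ {A : Set} {u v : A → ℕ} {x : A} {xs : List A} → (∀ x → u x ≤ v x) → x ∈ xs → u x < v x →
            sum (map u xs) < sum (map v xs)
sum-map-< {xs = _ ∷ xs} u≤v (here refl) u<v = +-mono-<-≤ u<v (sum-map-≤ xs u≤v)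
sum-map-< {xs = x ∷ _}  u≤v (there x∈)  u<v = +-mono-≤-< (u≤v x) (sum-map-< u≤v x∈ u<v)

-- The stack machine

-- The vectors (code_α(w)_i + s_ϱ(i))_i, where h i = s_ϱ(i).
record IsCode {n} (h t : Fin n → ℕ) : Set where
  field
    lower  : ∀ i → h i ≤ t i
    upper  : ∀ i → t i ≤ n
    within : ∀ {i j} → i <ᶠ j → h i ≡ h j → t i ≤ t j
    across : ∀ {i j} → h i < h j → h j ≤ t i → t j ≤ t i

rightmost-mono : ∀ ν {x y} → x ≤ y → rightmost ν x ≤ rightmost ν y
rightmost-mono []      x≤y       = z≤n
rightmost-mono (E ∷ ν) x≤y       = s≤s (rightmost-mono ν x≤y)
rightmost-mono (N ∷ ν) z≤n       = z≤n
rightmost-mono (N ∷ ν) (s≤s x≤y) = rightmost-mono ν x≤y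

rightmost-below : ∀ ν x y → x ≤ rightmost ν y → ∃[ y′ ] (x , y′) On ν × y′ ≤ y
rightmost-below ν       zero    y       _        = 0 , ([] , ν , refl , refl) , z≤n
rightmost-below (E ∷ ν) (suc x) y       (s≤s x≤) with rightmost-below ν x y x≤
... | y′ , (p , q , eq , e) , y′≤ = y′ , (E ∷ p , q , cong (E ∷_) eq , cong (map₁ suc) e) , y′≤
rightmost-below (N ∷ ν) (suc x) (suc y) x≤ with rightmost-below ν (suc x) y x≤
... | y′ , (p , q , eq , e) , y′≤ = suc y′ , (N ∷ p , q , cong (N ∷_) eq , cong (map₂ suc) e) , s≤s y′≤

module StackMachine {n : ℕ} (h : Fin n → ℕ) (h≤n : ∀ j → h j ≤ n) where

  push : ℕ → List (Fin n)
  push y = filter (λ j → h j ≟ y) (allFin n)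

  Log : Set
  Log = List (Fin n × ℕ)

  -- Height and stack before, path read, height and stack after, popped positions with their heights.
  data Run : ℕ → List (Fin n) → Path → ℕ → List (Fin n) → Log → Set where
    stop : ∀ {y st} → Run y st [] y st []
    pop  : ∀ {y j st p y′ st′ o} → Run y st p y′ st′ o → Run y (j ∷ st) (E ∷ p) y′ st′ ((j , y) ∷ o)
    rise : ∀ {y st p y′ st′ o} → Run (suc y) (push (suc y) ++ st) p y′ st′ o → Run y st (N ∷ p) y′ st′ o

  -- No north step leads to height 0, so the positions of that height must be on the stack from the
  -- start.
  FullRun : Path → Log → Set
  FullRun μ o = Run 0 (push 0) μ n [] o

  Realises : (Fin n → ℕ) → Log → Set
  Realises b o = ∀ {j v} → (j , v) ∈ o → b j ≡ v

  run-++ : ∀ {y st p y₁ st₁ o₁ q y₂ st₂ o₂} →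
           Run y st p y₁ st₁ o₁ → Run y₁ st₁ q y₂ st₂ o₂ → Run y st (p ++ q) y₂ st₂ (o₁ ++ o₂)
  run-++ stop     S = S
  run-++ (pop R)  S = pop (run-++ R S)
  run-++ (rise R) S = rise (run-++ R S)

  run-split : ∀ p {q y st y₂ st₂ o} → Run y st (p ++ q) y₂ st₂ o →
              ∃[ y₁ ] ∃[ st₁ ] ∃[ o₁ ] ∃[ o₂ ]
                Run y st p y₁ st₁ o₁ × Run y₁ st₁ q y₂ st₂ o₂ × o ≡ o₁ ++ o₂
  run-split []      R = _ , _ , _ , _ , stop , R , refl
  run-split (E ∷ p) (pop R) with run-split p R
  ... | _ , _ , _ , _ , R₁ , R₂ , refl = _ , _ , _ , _ , pop R₁ , R₂ , refl
  run-split (N ∷ p) (rise R) with run-split p R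
  ... | _ , _ , _ , _ , R₁ , R₂ , refl = _ , _ , _ , _ , rise R₁ , R₂ , refl

  run-det : ∀ {y st p y₁ st₁ o₁ y₂ st₂ o₂} → Run y st p y₁ st₁ o₁ → Run y st p y₂ st₂ o₂ →
            y₁ ≡ y₂ × st₁ ≡ st₂ × o₁ ≡ o₂
  run-det stop     stop     = refl , refl , refl
  run-det (pop R)  (pop S)  with run-det R S
  ... | refl , refl , refl = refl , refl , refl
  run-det (rise R) (rise S) = run-det R S

  run-height : ∀ {y st p y′ st′ o} → Run y st p y′ st′ o → y ≤ y′
  run-height stop     = ≤-refl
  run-height (pop R)  = run-height R
  run-height (rise R) = <⇒≤ (run-height R)

  ∈-push⁺ : ∀ {j y} → h j ≡ y → j ∈ push y
  ∈-push⁺ {j} {y} e = ∈-filter⁺ (λ k → h k ≟ y) (∈-allFin j) e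

  ∈-push⁻ : ∀ y {j} → j ∈ push y → h j ≡ y
  ∈-push⁻ y j∈ = proj₂ (∈-filter⁻ (λ k → h k ≟ y) {xs = allFin n} j∈)

  -- The stack order, from the top: higher regions first, left to right inside a region.
  Above : Fin n → Fin n → Set
  Above i j = h j < h i ⊎ (h i ≡ h j × i <ᶠ j)

  record Ordered (y : ℕ) (st : List (Fin n)) : Set where
    constructor ordered
    field
      bounded : All (λ j → h j ≤ y) st
      sorted  : AllPairs Above st

  push-sorted : ∀ y → AllPairs _<ᶠ_ (push y)
  push-sorted y = AllPairsₚ.filter⁺ (λ k → h k ≟ y) (AllPairsₚ.tabulate⁺-< id)

  push-above : ∀ y → AllPairs Above (push y)
  push-above y = AllPairs-map∈
    (λ i∈ j∈ i<j → inj₂ (trans (∈-push⁻ y i∈) (sym (∈-push⁻ y j∈)) , i<j)) (push-sorted y)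

  ordered-start : Ordered 0 (push 0)
  ordered-start = ordered (All.tabulate (≤-reflexive ∘ ∈-push⁻ 0)) (push-above 0)

  ordered-pop : ∀ {y j st} → Ordered y (j ∷ st) → Ordered y st
  ordered-pop (ordered (_ ∷ bd) (_ ∷ sd)) = ordered bd sd

  ordered-rise : ∀ {y st} → Ordered y st → Ordered (suc y) (push (suc y) ++ st)
  ordered-rise {y} (ordered bd sd) = ordered
    (Allₚ.++⁺ (All.tabulate (≤-reflexive ∘ ∈-push⁻ (suc y))) (All.map m≤n⇒m≤1+n bd))
    (AllPairsₚ.++⁺ (push-above _) sd
      (All.tabulate λ i∈ → All.map (λ hj≤y → inj₁ (≤-trans (s≤s hj≤y) (≤-reflexive (sym (∈-push⁻ (suc y) i∈))))) bd))

  run-ordered : ∀ {y st p y′ st′ o} → Run y st p y′ st′ o → Ordered y st → Ordered y′ st′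
  run-ordered stop     = id
  run-ordered (pop R)  = run-ordered R ∘ ordered-pop
  run-ordered (rise R) = run-ordered R ∘ ordered-rise

  -- Positions still to be popped, and the values a run records.

  Pending : ℕ → List (Fin n) → Fin n → Set
  Pending y st j = j ∈ st ⊎ y < h j

  pending-rise : ∀ {y st j} → Pending y st j → Pending (suc y) (push (suc y) ++ st) j
  pending-rise {y} (inj₁ j∈) = inj₁ (∈-++⁺ʳ (push (suc y)) j∈)
  pending-rise {y} {j = j} (inj₂ y<h) with h j ≟ suc y
  ... | yes e = inj₁ (∈-++⁺ˡ (∈-push⁺ e))
  ... | no ne = inj₂ (≤∧≢⇒< y<h (ne ∘ sym))

  pending-rise⁻ : ∀ {y st j} → Pending (suc y) (push (suc y) ++ st) j → Pending y st j
  pending-rise⁻ {y} (inj₁ j∈) with ∈-++⁻ (push (suc y)) j∈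
  ... | inj₁ j∈p  = inj₂ (≤-reflexive (sym (∈-push⁻ (suc y) j∈p)))
  ... | inj₂ j∈st = inj₁ j∈st
  pending-rise⁻ (inj₂ lt) = inj₂ (<⇒≤ lt)

  pending-start : ∀ j → Pending 0 (push 0) j
  pending-start j with h j in e
  ... | zero  = inj₁ (∈-push⁺ e)
  ... | suc _ = inj₂ (s≤s z≤n)

  popped : ∀ {y st p y′ o j} → Run y st p y′ [] o → h j ≤ y′ → Pending y st j → ∃[ v ] (j , v) ∈ o
  popped stop     hj≤ (inj₂ y<h)         = ⊥-elim (<⇒≱ y<h hj≤)
  popped (pop R)  hj≤ (inj₁ (here refl)) = _ , here refl
  popped (pop R)  hj≤ (inj₁ (there j∈))  = map₂ there (popped R hj≤ (inj₁ j∈))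
  popped (pop R)  hj≤ (inj₂ y<h)         = map₂ there (popped R hj≤ (inj₂ y<h))
  popped (rise R) hj≤ pd                 = popped R hj≤ (pending-rise pd)

  log-pending : ∀ {y st p y′ st′ o j v} → Run y st p y′ st′ o → (j , v) ∈ o → Pending y st j
  log-pending (pop R)  (here refl) = inj₁ (here refl)
  log-pending (pop R)  (there j∈) with log-pending R j∈
  ... | inj₁ j∈st = inj₁ (there j∈st)
  ... | inj₂ y<h  = inj₂ y<h
  log-pending (rise R) j∈ = pending-rise⁻ (log-pending R j∈)

  log-≥ : ∀ {y st p y′ st′ o j v} → Run y st p y′ st′ o → (j , v) ∈ o → y ≤ v
  log-≥ (pop R)  (here refl) = ≤-refl
  log-≥ (pop R)  (there j∈)  = log-≥ R j∈
  log-≥ (rise R) j∈          = <⇒≤ (log-≥ R j∈)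

  log-≤ : ∀ {y st p y′ st′ o j v} → Run y st p y′ st′ o → (j , v) ∈ o → v ≤ y′
  log-≤ (pop R)  (here refl) = run-height R
  log-≤ (pop R)  (there j∈)  = log-≤ R j∈
  log-≤ (rise R) j∈          = log-≤ R j∈

  log-h≤ : ∀ {y st p y′ st′ o j v} → Run y st p y′ st′ o → Ordered y st → (j , v) ∈ o → h j ≤ v
  log-h≤ (pop R)  od (here refl) = All.head (Ordered.bounded od)
  log-h≤ (pop R)  od (there j∈)  = log-h≤ R (ordered-pop od) j∈
  log-h≤ (rise R) od j∈          = log-h≤ R (ordered-rise od) j∈

  above-irrefl : ∀ {j} → ¬ Above j j
  above-irrefl (inj₁ lt)       = <-irrefl refl lt
  above-irrefl (inj₂ (_ , lt)) = <-irrefl refl lt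

  -- A log assigns at most one value to a position: once popped, a position is never pending again,
  -- because the stack is strictly ordered and its height has been passed. The default 0 only
  -- concerns positions absent from the log.
  realisation : ∀ {y st p y′ st′ o} → Run y st p y′ st′ o → Ordered y st → ∃[ b ] Realises b o
  realisation stop     od = (λ _ → 0) , λ ()
  realisation (rise R) od = realisation R (ordered-rise od)
  realisation {y} (pop {j = j} {st = st} {o = o} R) od with realisation R (ordered-pop od)
  ... | b , br = b′ , br′
    where
    b′ : Fin n → ℕ
    b′ k with k Finₚ.≟ j
    ... | yes _ = y
    ... | no  _ = b k
    not-pending : ¬ Pending y st j
    not-pending (inj₁ j∈) with Ordered.sorted od
    ... | ab ∷ _ = above-irrefl (All.lookup ab j∈)
    not-pending (inj₂ lt) = <⇒≱ lt (All.head (Ordered.bounded od))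
    br′ : Realises b′ ((j , y) ∷ o)
    br′ {k} kv∈ with k Finₚ.≟ j
    br′ (here refl) | yes _    = refl
    br′ (there k∈)  | yes refl = ⊥-elim (not-pending (log-pending R k∈))
    br′ (here refl) | no ne    = ⊥-elim (ne refl)
    br′ (there k∈)  | no _     = br k∈

  -- The log is a list, so that it splits along a path, while `b` is a function, so that vectors of
  -- different paths can be compared position by position.
  record Completes (y : ℕ) (st : List (Fin n)) (p : Path) (b : Fin n → ℕ) : Set where
    constructor completes
    field
      {log}    : Log
      run      : Run y st p n [] log
      realises : Realises b log

  Complete : Path → (Fin n → ℕ) → Set
  Complete = Completes 0 (push 0)

  realises-tail : ∀ {b e o} → Realises b (e ∷ o) → Realises b o
  realises-tail r = r ∘ there

  -- Recorded vectors satisfy the code conditions.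

  AllPairs-sorted : ∀ {R : Fin n → Fin n → Set} {xs i j} → AllPairs _<ᶠ_ xs → AllPairs R xs →
                    i ∈ xs → j ∈ xs → i <ᶠ j → R i j
  AllPairs-sorted (lt ∷ lts) (r ∷ rs) (here refl) (here refl) i<j = ⊥-elim (<-irrefl refl i<j)
  AllPairs-sorted (lt ∷ lts) (r ∷ rs) (here refl) (there j∈)  i<j = All.lookup r j∈
  AllPairs-sorted (lt ∷ lts) (r ∷ rs) (there i∈)  (here refl) i<j = ⊥-elim (<-asym i<j (All.lookup lt i∈))
  AllPairs-sorted (lt ∷ lts) (r ∷ rs) (there i∈)  (there j∈)  i<j = AllPairs-sorted lts rs i∈ j∈ i<j

  stack-≥ : ∀ {b y st p} → Completes y st p b → ∀ {j} → j ∈ st → y ≤ b j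
  stack-≥ (completes R r) {j} j∈ with popped R (h≤n j) (inj₁ j∈)
  ... | v , jv∈ = subst (_ ≤_) (sym (r jv∈)) (log-≥ R jv∈)

  -- Entries leave from the top while the height only grows, so an entry nearer the top never
  -- records a larger value.
  stack-sorted : ∀ {b y st p} → Completes y st p b → AllPairs (λ i j → b i ≤ b j) st
  stack-sorted (completes stop     r) = []
  stack-sorted (completes (pop R)  r) =
    All.tabulate (λ j∈ → subst (_≤ _) (sym (r (here refl))) (stack-≥ (completes R (realises-tail r)) j∈)) ∷
    stack-sorted (completes R (realises-tail r))
  stack-sorted (completes (rise {y} R) r) = AllPairs-++ʳ (push (suc y)) (stack-sorted (completes R r))

  private
    within-later : ∀ {b y st p i j} → Completes y st p b → y < h i → i <ᶠ j → h i ≡ h j → b i ≤ b j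
    within-later {i = i} (completes stop    r) n<h _ _ = ⊥-elim (<⇒≱ n<h (h≤n i))
    within-later (completes (pop R) r) y<h = within-later (completes R (realises-tail r)) y<h
    within-later {i = i} (completes (rise {y} R) r) y<h i<j e with h i ≟ suc y
    ... | yes e′ = AllPairs-sorted (push-sorted (suc y))
                     (AllPairs-++ˡ (push (suc y)) (stack-sorted (completes R r)))
                     (∈-push⁺ e′) (∈-push⁺ (trans (sym e) e′)) i<j
    ... | no ne  = within-later (completes R r) (≤∧≢⇒< y<h (ne ∘ sym)) i<j e

    -- Because of `h j ≤ b i`, position `i` is still on the stack when `j` is pushed above it; from
    -- then on `stack-sorted` compares the two.
    across-stack : ∀ {b y st p i j} → Completes y st p b → i ∈ st → y < h j → h j ≤ b i → b j ≤ b i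
    across-stack (completes (pop R) r) (here refl) y<h h≤b =
      ⊥-elim (<⇒≱ y<h (subst (_ ≤_) (r (here refl)) h≤b))
    across-stack (completes (pop R) r) (there i∈) y<h h≤b =
      across-stack (completes R (realises-tail r)) i∈ y<h h≤b
    across-stack {j = j} (completes (rise {y} R) r) i∈ y<h h≤b with h j ≟ suc y
    ... | yes e = AllPairs-cross (stack-sorted (completes R r)) (∈-push⁺ e) i∈
    ... | no ne = across-stack (completes R r) (∈-++⁺ʳ (push (suc y)) i∈) (≤∧≢⇒< y<h (ne ∘ sym)) h≤b

    across-later : ∀ {b y st p i j} → Completes y st p b → y < h i → h i < h j → h j ≤ b i → b j ≤ b i
    across-later {i = i} (completes stop    r) n<h _ _ = ⊥-elim (<⇒≱ n<h (h≤n i))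
    across-later (completes (pop R) r) y<h = across-later (completes R (realises-tail r)) y<h
    across-later {i = i} {j} (completes (rise {y} R) r) y<h hi<hj h≤b with h i ≟ suc y
    ... | yes e = across-stack (completes R r) (∈-++⁺ˡ (∈-push⁺ e)) (subst (_< h j) e hi<hj) h≤b
    ... | no ne = across-later (completes R r) (≤∧≢⇒< y<h (ne ∘ sym)) hi<hj h≤b

  complete⇒isCode : ∀ {p b} → Complete p b → IsCode h b
  complete⇒isCode {b = b} c@(completes R r) = record
    { lower  = λ i → let v , iv∈ = label i in subst (h i ≤_) (sym (r iv∈)) (log-h≤ R ordered-start iv∈)
    ; upper  = λ i → let v , iv∈ = label i in subst (_≤ n) (sym (r iv∈)) (log-≤ R iv∈)
    ; within = within
    ; across = across
    }
    where
    label : ∀ i → ∃[ v ] (i , v) ∈ _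
    label i = popped R (h≤n i) (pending-start i)
    within : ∀ {i j} → i <ᶠ j → h i ≡ h j → b i ≤ b j
    -- Height 0 is separate: its positions belong to the initial stack, whereas `within-later` waits
    -- for the `rise` that pushes `i` and `j` together.
    within {i} i<j e with h i in e′
    ... | zero  = AllPairs-sorted (push-sorted 0) (stack-sorted c) (∈-push⁺ e′) (∈-push⁺ (sym e)) i<j
    ... | suc _ = within-later c (subst (0 <_) (sym e′) (s≤s z≤n)) i<j (trans e′ e)
    across : ∀ {i j} → h i < h j → h j ≤ b i → b j ≤ b i
    across {i} {j} hi<hj with h i in e′
    ... | zero  = across-stack c (∈-push⁺ e′) hi<hj
    ... | suc _ = across-later c (subst (0 <_) (sym e′) (s≤s z≤n)) (subst (_< h j) (sym e′) hi<hj)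

  -- A code vector determines a path, and every code vector has one.

  completes-path-unique : ∀ {y st p p′ b b′} → Completes y st p b → Completes y st p′ b′ →
                          (∀ j → b j ≡ b′ j) → p ≡ p′
  completes-path-unique (completes stop r) (completes stop r′) e = refl
  completes-path-unique (completes stop r) (completes (rise R′) r′) e = ⊥-elim (1+n≰n (run-height R′))
  completes-path-unique (completes (rise R) r) (completes stop r′) e = ⊥-elim (1+n≰n (run-height R))
  completes-path-unique (completes (pop R) r) (completes (pop R′) r′) e =
    cong (E ∷_) (completes-path-unique (completes R (realises-tail r)) (completes R′ (realises-tail r′)) e)
  completes-path-unique (completes (rise R) r) (completes (rise R′) r′) e =
    cong (N ∷_) (completes-path-unique (completes R r) (completes R′ r′) e)
  -- At the first disagreement one path pops a position at height `y`, while the other rises with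
  -- that position still on its stack and so gives it a value above `y`.
  completes-path-unique (completes (pop {y} R) r) (completes (rise R′) r′) e =
    ⊥-elim (1+n≰n (≤-trans (stack-≥ (completes R′ r′) (∈-++⁺ʳ (push (suc y)) (here refl)))
                           (≤-reflexive (trans (sym (e _)) (r (here refl))))))
  completes-path-unique (completes (rise {y} R) r) (completes (pop R′) r′) e =
    ⊥-elim (1+n≰n (≤-trans (stack-≥ (completes R r) (∈-++⁺ʳ (push (suc y)) (here refl)))
                           (≤-reflexive (trans (e _) (r′ (here refl))))))

  -- Sortedness puts the entries of value `y` on top, so they are popped consecutively. The rest of
  -- the path comes from a continuation, which receives the remaining stack with its invariants and
  -- the unchanged counts of larger values.
  pops-sorted : ∀ {t : Fin n → ℕ} {y} rest st → AllPairs (λ i j → t i ≤ t j) st → All (λ j → y ≤ t j) st →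
    Ordered y st →
    (∀ st′ → AllPairs (λ i j → t i ≤ t j) st′ → All (λ j → y < t j) st′ → Ordered y st′ →
       (∀ v → y < v → length (filter (λ j → t j ≟ v) st′) ≡ length (filter (λ j → t j ≟ v) st)) →
       Completes y st′ rest t) →
    Completes y st (replicate (length (filter (λ j → t j ≟ y) st)) E ++ rest) t
  pops-sorted rest [] sd ge od k = k [] [] [] od (λ _ _ → refl)
  pops-sorted {t} {y} rest (j ∷ st) (lt ∷ sd) (ge ∷ ges) od k with t j ≟ y
  ... | yes e rewrite filter-accept (λ i → t i ≟ y) {j} {st} e = cons (pops-sorted rest st sd ges (ordered-pop od)
                  (λ st′ sd′ gt od′ cnt → k st′ sd′ gt od′ (λ v y<v → trans (cnt v y<v)
                    (cong length (sym (filter-reject (λ j → t j ≟ v) (λ e′ → <-irrefl (trans (sym e) e′) y<v)))))))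
    where
    cons : ∀ {p} → Completes y st p t → Completes y (j ∷ st) (E ∷ p) t
    cons (completes R r) = completes (pop R) λ { (here refl) → e ; (there j∈) → r j∈ }
  -- The head already exceeds `y`, so no entry has value `y` and there is nothing to pop at this
  -- height.
  ... | no ne rewrite trans (filter-reject (λ i → t i ≟ y) {j} {st} ne) 
      (filter-none (λ j → t j ≟ y) {st} (All.map (λ j≤ e → ne (≤-antisym (≤-trans j≤ (≤-reflexive e)) ge)) lt)) =
    k (j ∷ st) (lt ∷ sd) (y<tj ∷ All.map (<-≤-trans y<tj) lt) od (λ _ _ → refl)
    where
    y<tj : y < t j
    y<tj = ≤∧≢⇒< ge (ne ∘ sym)

  module _ {t : Fin n → ℕ} (isCode : IsCode h t) where
    open IsCode isCode

    count : ℕ → ℕ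
    count v = length (filter (λ j → t j ≟ v) (allFin n))

    future : ℕ → List (Fin n)
    future y = filter (λ j → y <? h j) (allFin n)

    private
      future-rise : ∀ y → future y ↭ push (suc y) ++ future (suc y)
      future-rise y = filter-⊎ (λ j → y <? h j) (λ j → h j ≟ suc y) (λ j → suc y <? h j) split
        (≤-reflexive ∘ sym) <⇒≤ (λ e lt → <-irrefl (sym e) lt) (allFin n)
        where
        split : ∀ {j} → y < h j → h j ≡ suc y ⊎ suc y < h j
        split {j} lt with h j ≟ suc y
        ... | yes e = inj₁ e
        ... | no ne = inj₂ (≤∧≢⇒< lt (ne ∘ sym))

      cnt : ℕ → List (Fin n) → ℕ
      cnt v xs = length (filter (λ j → t j ≟ v) xs)

      cnt-++ : ∀ v xs ys → cnt v (xs ++ ys) ≡ cnt v xs + cnt v ys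
      cnt-++ v xs ys = trans (cong length (filter-++ (λ j → t j ≟ v) xs ys)) (length-++ (filter (λ j → t j ≟ v) xs))

      cnt-future : ∀ y → cnt y (future y) ≡ 0
      cnt-future y = cong length (filter-none (λ j → t j ≟ y) (All.tabulate λ {j} j∈ e →
        <⇒≱ (proj₂ (∈-filter⁻ (λ j → y <? h j) {xs = allFin n} j∈)) (subst (h j ≤_) e (lower j))))

      push-sorted-code : ∀ {y st} → Ordered y st → All (λ j → y < t j) st → AllPairs (λ i j → t i ≤ t j) st →
                         AllPairs (λ i j → t i ≤ t j) (push (suc y) ++ st)
      push-sorted-code {y} od gt sd = AllPairsₚ.++⁺
        (AllPairs-map∈ (λ i∈ j∈ i<j → within i<j (trans (∈-push⁻ (suc y) i∈) (sym (∈-push⁻ (suc y) j∈)))) (push-sorted (suc y)))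
        sd
        (All.tabulate λ {i} i∈ → All.tabulate λ {j} j∈ →
          across (≤-trans (s≤s (All.lookup (Ordered.bounded od) j∈)) (≤-reflexive (sym (∈-push⁻ (suc y) i∈))))
                 (≤-trans (≤-reflexive (∈-push⁻ (suc y) i∈)) (All.lookup gt j∈)))

      -- The last hypothesis is the invariant: a position of value `v ≥ y` is on the stack or not
      -- yet pushed. Positions not yet pushed have values above `y` by `lower`, so the exponent
      -- prescribed at height `y` counts stack entries only.
      bracket-completes : ∀ k y st (g : Fin (suc k) → ℕ) → y + k ≡ n → (∀ i → g i ≡ count (y + toℕ i)) →
        AllPairs (λ i j → t i ≤ t j) st → All (λ j → y ≤ t j) st → Ordered y st →
        (∀ v → y ≤ v → count v ≡ cnt v st + cnt v (future y)) →
        Completes y st (bracket (tabulate g)) t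
      bracket-completes k y st g yk≡n geq sd ge od ceq
        rewrite trans (geq Fin.zero) (trans (cong count (+-identityʳ y))
                 (trans (ceq y ≤-refl) (trans (cong (cnt y st +_) (cnt-future y)) (+-identityʳ _))))
        with k
      ... | zero = subst (λ p → Completes y st p t) (++-identityʳ _) (pops-sorted [] st sd ge od last)
        where
        last : ∀ st′ → _ → All (λ j → y < t j) st′ → _ → _ → Completes y st′ [] t
        last [] _ _ _ _ = subst (λ z → Completes z [] [] t) (trans (sym yk≡n) (+-identityʳ y)) (completes stop λ ())
        -- An entry left at the top height would have a value above `n`, against `upper`.
        last (j ∷ _) _ (lt ∷ _) _ _ = ⊥-elim (<⇒≱ lt (subst (t j ≤_) (trans (sym yk≡n) (+-identityʳ y)) (upper j)))
      ... | suc k′ = pops-sorted _ st sd ge od next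
        where
        next : ∀ st′ → AllPairs (λ i j → t i ≤ t j) st′ → All (λ j → y < t j) st′ → Ordered y st′ →
               (∀ v → y < v → cnt v st′ ≡ cnt v st) → Completes y st′ (N ∷ bracket (tabulate (g ∘ Fin.suc))) t
        next st′ sd′ gt od′ ceq′ = up (bracket-completes k′ (suc y) (push (suc y) ++ st′) (g ∘ Fin.suc)
          (trans (sym (+-suc y k′)) yk≡n)
          (λ i → trans (geq (Fin.suc i)) (cong count (+-suc y (toℕ i))))
          (push-sorted-code od′ gt sd′)
          (Allₚ.++⁺ (All.tabulate λ {j} j∈ → subst (_≤ t j) (∈-push⁻ (suc y) j∈) (lower j)) gt)
          (ordered-rise od′)
          counts)
          where
          up : ∀ {p} → Completes (suc y) (push (suc y) ++ st′) p t → Completes y st′ (N ∷ p) t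
          up (completes R r) = completes (rise R) r
          counts : ∀ v → suc y ≤ v → count v ≡ cnt v (push (suc y) ++ st′) + cnt v (future (suc y))
          counts v y<v = begin
            count v ≡⟨ ceq v (<⇒≤ y<v) ⟩
            cnt v st + cnt v (future y) ≡⟨ cong₂ _+_ (sym (ceq′ v y<v)) (↭-length (filter-↭ (λ j → t j ≟ v) (future-rise y))) ⟩
            cnt v st′ + cnt v (push (suc y) ++ future (suc y)) ≡⟨ cong (cnt v st′ +_) (cnt-++ v (push (suc y)) _) ⟩
            cnt v st′ + (cnt v (push (suc y)) + cnt v (future (suc y))) ≡⟨ sym (+-assoc (cnt v st′) _ _) ⟩
            cnt v st′ + cnt v (push (suc y)) + cnt v (future (suc y)) ≡⟨ cong (_+ cnt v (future (suc y))) (+-comm (cnt v st′) _) ⟩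
            cnt v (push (suc y)) + cnt v st′ + cnt v (future (suc y)) ≡⟨ cong (_+ cnt v (future (suc y))) (sym (cnt-++ v (push (suc y)) st′)) ⟩
            cnt v (push (suc y) ++ st′) + cnt v (future (suc y)) ∎
            where open ≡-Reasoning

    code-completes : Complete (bracket (tabulate {n = suc n} (λ i → count (toℕ i)))) t
    code-completes = bracket-completes n 0 (push 0) _ refl (λ _ → refl)
      (AllPairs-map∈ (λ i∈ j∈ i<j → within i<j (trans (∈-push⁻ 0 i∈) (sym (∈-push⁻ 0 j∈)))) (push-sorted 0))
      (All.tabulate λ _ → z≤n) ordered-start
      (λ v _ → trans (↭-length (filter-↭ (λ j → t j ≟ v) start)) (cnt-++ v (push 0) (future 0)))
      where
      everything : ∀ (xs : List (Fin n)) → xs ↭ filter (λ j → h j ≟ 0) xs ++ filter (λ j → 0 <? h j) xs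
      everything [] = ↭-refl
      everything (x ∷ xs) with h x
      ... | zero  = prep x (everything xs)
      ... | suc _ = ↭-trans (prep x (everything xs)) (↭-sym (shift x (filter (λ j → h j ≟ 0) xs) _))
      start : allFin n ↭ push 0 ++ future 0
      start = everything (allFin n)

  -- Stack sizes, and runs as paths weakly above the lower path.

  reach : ℕ → ℕ
  reach y = length (filter (λ j → h j ≤? y) (allFin n))

  reach-suc : ∀ y → reach (suc y) ≡ length (push (suc y)) + reach y
  reach-suc y = trans (↭-length (filter-⊎ (λ j → h j ≤? suc y) (λ j → h j ≟ suc y) (λ j → h j ≤? y) split
      ≤-reflexive m≤n⇒m≤1+n (λ e le → <-irrefl e (s≤s le)) (allFin n)))
    (length-++ (push (suc y)))
    where
    split : ∀ {j} → h j ≤ suc y → h j ≡ suc y ⊎ h j ≤ y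
    split {j} le with h j ≟ suc y
    ... | yes e = inj₁ e
    ... | no ne = inj₂ (≤-pred (≤∧≢⇒< le ne))

  reach-zero : length (push 0) ≡ reach 0
  reach-zero = trans (sym (+-identityʳ _)) (trans (cong (length (push 0) +_) (cong length (sym none)))
    (sym (trans (↭-length (filter-⊎ (λ j → h j ≤? 0) (λ j → h j ≟ 0) (λ j → h j <? 0) (inj₁ ∘ n≤0⇒n≡0)
       ≤-reflexive (λ ()) (λ _ ()) (allFin n))) (length-++ (push 0)))))
    where
    none : filter (λ j → h j <? 0) (allFin n) ≡ []
    none = filter-none (λ j → h j <? 0) {allFin n} (All.tabulate λ _ ())

  reach-top : reach n ≡ n
  reach-top = trans
    (cong length (filter-all (λ j → h j ≤? n) {allFin n} (All.tabulate λ {j} _ → h≤n j)))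
    (length-tabulate {n = n} id)

  run-height-≡ : ∀ {y st p y′ st′ o} → Run y st p y′ st′ o → proj₂ (endpoint p) + y ≡ y′
  run-height-≡ stop     = refl
  run-height-≡ (pop R)  = run-height-≡ R
  run-height-≡ (rise {y} {p = p} R) = trans (sym (+-suc (proj₂ (endpoint p)) y)) (run-height-≡ R)

  -- A conservation law: between heights `y` and `y′` the machine pushes `reach y′ ∸ reach y`
  -- positions, and each east step removes one. The additive form avoids truncated subtraction.
  run-width : ∀ {y st p y′ st′ o} → Run y st p y′ st′ o →
              proj₁ (endpoint p) + length st′ + reach y ≡ length st + reach y′
  run-width stop    = refl
  run-width (pop R) = cong suc (run-width R)
  run-width (rise {y} {st} {p} {y′} {st′} R) = +-cancelˡ-≡ a _ _ (begin
    a + (x + l + reach y)              ≡⟨ sym (+-assoc a _ _) ⟩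
    a + (x + l) + reach y              ≡⟨ cong (_+ reach y) (+-comm a _) ⟩
    x + l + a + reach y                ≡⟨ +-assoc (x + l) a _ ⟩
    x + l + (a + reach y)              ≡⟨ cong (x + l +_) (sym (reach-suc y)) ⟩
    x + l + reach (suc y)              ≡⟨ run-width R ⟩
    length (push (suc y) ++ st) + reach y′ ≡⟨ cong (_+ reach y′) (length-++ (push (suc y))) ⟩
    a + length st + reach y′           ≡⟨ +-assoc a _ _ ⟩
    a + (length st + reach y′) ∎)
    where
    open ≡-Reasoning
    a = length (push (suc y))
    x = proj₁ (endpoint p)
    l = length st′

  -- The machine gets stuck only at an east step on an empty stack. Then `x` equals `reach y`, and
  -- one more east step would violate the bound on prefixes.
  run-exists : ∀ p y st x → x + length st ≡ reach y →
    (∀ q r → p ≡ q ++ r → proj₁ (endpoint q) + x ≤ reach (proj₂ (endpoint q) + y)) →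
    ∃[ y′ ] ∃[ st′ ] ∃[ o ] Run y st p y′ st′ o
  run-exists [] y st x e safe = _ , _ , _ , stop
  run-exists (E ∷ p) y [] x e safe =
    ⊥-elim (1+n≰n (≤-trans (safe (E ∷ []) p refl) (≤-reflexive (trans (sym e) (+-identityʳ x)))))
  run-exists (E ∷ p) y (j ∷ st) x e safe
    with run-exists p y st (suc x) (trans (sym (+-suc x (length st))) e)
           (λ q r eq → ≤-trans (≤-reflexive (+-suc (proj₁ (endpoint q)) x)) (safe (E ∷ q) r (cong (E ∷_) eq)))
  ... | _ , _ , _ , R = _ , _ , _ , pop R
  run-exists (N ∷ p) y st x e safe
    with run-exists p (suc y) (push (suc y) ++ st) x grow
           (λ q r eq → ≤-trans (safe (N ∷ q) r (cong (N ∷_) eq)) (≤-reflexive (cong reach (sym (+-suc (proj₂ (endpoint q)) y)))))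
    where
    grow : x + length (push (suc y) ++ st) ≡ reach (suc y)
    grow = begin
      x + length (push (suc y) ++ st) ≡⟨ cong (x +_) (trans (length-++ (push (suc y))) (+-comm (length (push (suc y))) _)) ⟩
      x + (length st + length (push (suc y))) ≡⟨ sym (+-assoc x _ _) ⟩
      x + length st + length (push (suc y)) ≡⟨ cong (_+ length (push (suc y))) e ⟩
      reach y + length (push (suc y)) ≡⟨ +-comm (reach y) _ ⟩
      length (push (suc y)) + reach y ≡⟨ sym (reach-suc y) ⟩
      reach (suc y) ∎
      where open ≡-Reasoning
  ... | _ , _ , _ , R = _ , _ , _ , rise R

  module OverPath (ν : Path) (endν : endpoint ν ≡ (n , n)) (rightmostν : ∀ y → rightmost ν y ≡ reach y) where

    width+stack : ∀ {p y st o} → Run 0 (push 0) p y st o → proj₁ (endpoint p) + length st ≡ rightmost ν y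
    width+stack {p} {y} {st} R = +-cancelʳ-≡ (reach 0) _ _ (begin
      proj₁ (endpoint p) + length st + reach 0 ≡⟨ run-width R ⟩
      length (push 0) + reach y ≡⟨ cong (_+ reach y) reach-zero ⟩
      reach 0 + reach y ≡⟨ +-comm (reach 0) _ ⟩
      reach y + reach 0 ≡⟨ cong (_+ reach 0) (sym (rightmostν y)) ⟩
      rightmost ν y + reach 0 ∎)
      where open ≡-Reasoning

    run-top : ∀ {p y st o} → Run 0 (push 0) p y st o → proj₂ (endpoint p) ≡ y
    run-top R = trans (sym (+-identityʳ _)) (run-height-≡ R)

    horiz≡length : ∀ {p y st o} → Run 0 (push 0) p y st o → horiz ν (endpoint p) ≡ length st
    horiz≡length {p} {y} {st} R
      rewrite run-top R | sym (width+stack R) = m+n∸m≡n (proj₁ (endpoint p)) (length st)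

    fullRun⇒∈𝓛 : ∀ {μ o} → FullRun μ o → μ ∈𝓛 ν
    fullRun⇒∈𝓛 {μ} R = record
      { sameEnd    = trans (cong₂ _,_
          (trans (sym (+-identityʳ _)) (trans (width+stack R) (trans (rightmostν n) reach-top)))
          (run-top R)) (sym endν)
      ; neverBelow = below
      }
      where
      below : ∀ {x y} → (x , y) On μ → ∃[ y′ ] (x , y′) On ν × y′ ≤ y
      below {x} {y} (p , q , refl , refl) with run-split p R
      ... | y₁ , st₁ , _ , _ , R₁ , _ , _ = rightmost-below ν x y
        (subst (λ z → x ≤ rightmost ν z) (sym (run-top R₁)) (subst (x ≤_) (width+stack R₁) (m≤m+n x _)))

    ∈𝓛⇒fullRun : ∀ {μ} → μ ∈𝓛 ν → ∃[ o ] FullRun μ o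
    ∈𝓛⇒fullRun {μ} μ∈ with run-exists μ 0 (push 0) 0 reach-zero safe
      where
      safe : ∀ q r → μ ≡ q ++ r → proj₁ (endpoint q) + 0 ≤ reach (proj₂ (endpoint q) + 0)
      safe q r eq with _∈𝓛_.neverBelow μ∈ (q , r , eq , refl)
      ... | y′ , on , y′≤ rewrite +-identityʳ (proj₁ (endpoint q)) | +-identityʳ (proj₂ (endpoint q)) =
        subst (_ ≤_) (rightmostν _) (≤-trans (rightmost-max ν on) (rightmost-mono ν y′≤))
    ... | y′ , st′ , o , R = o , finish (trans (sym (run-top R)) (cong proj₂ end)) R
      where
      end : endpoint μ ≡ (n , n)
      end = trans (_∈𝓛_.sameEnd μ∈) endν
      finish : y′ ≡ n → Run 0 (push 0) μ y′ st′ o → FullRun μ o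
      -- The path ends at width `n`, which is also the width of the lower path at height `n`; this
      -- leaves no entry on the stack.
      finish refl R = subst (λ st → Run 0 (push 0) μ n st o) (length≡0 st′ (+-cancelˡ-≡ n _ _
        (trans (cong (_+ length st′) (sym (cong proj₁ end)))
          (trans (width+stack R) (trans (rightmostν n) (trans reach-top (sym (+-identityʳ n)))))))) R
        where
        length≡0 : ∀ (xs : List (Fin n)) → length xs ≡ 0 → xs ≡ []
        length≡0 [] _ = refl

    ∈𝓛⇒complete : ∀ {μ} → μ ∈𝓛 ν → ∃[ b ] Complete μ b
    ∈𝓛⇒complete μ∈ with ∈𝓛⇒fullRun μ∈
    ... | _ , R with realisation R ordered-start
    ... | b , br = b , completes R br

    -- A path returning to the height of S only at its end never touches S, so it runs on top of any S′.
    reframe : ∀ X {S y q y′ T o} → Run y (X ++ S) q y′ T o → length T ≡ length S →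
      (∀ q₁ q₂ {y₁ T₁ o₁} → q ≡ q₁ ++ q₂ → q₂ ≢ [] → Run y (X ++ S) q₁ y₁ T₁ o₁ → length T₁ ≢ length S) →
      T ≡ S × (∀ S′ → Run y (X ++ S′) q y′ S′ o)
    reframe []      {q = []}    stop len above = refl , λ _ → stop
    reframe []      {q = _ ∷ _} R    len above = ⊥-elim (above [] _ refl (λ ()) stop refl)
    reframe (x ∷ X) {S} stop len above = ⊥-elim (1+n≰n
      (≤-trans (s≤s (subst (length S ≤_) (sym (length-++ X)) (m≤n+m _ (length X)))) (≤-reflexive len)))
    reframe (x ∷ X) (pop R) len above
      with reframe X R len (λ q₁ q₂ eq ne R₁ → above (E ∷ q₁) q₂ (cong (E ∷_) eq) ne (pop R₁))
    ... | T≡S , R′ = T≡S , λ S′ → pop (R′ S′)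
    reframe (x ∷ X) {S} {y} {N ∷ q} (rise R) len above
      with reframe (push (suc y) ++ x ∷ X) {S}
             (subst (λ st → Run (suc y) st q _ _ _) (sym (++-assoc (push (suc y)) (x ∷ X) S)) R) len
             (λ q₁ q₂ eq ne R₁ → above (N ∷ q₁) q₂ (cong (N ∷_) eq) ne
                (rise (subst (λ st → Run (suc y) st q₁ _ _ _) (++-assoc (push (suc y)) (x ∷ X) S) R₁)))
    ... | T≡S , R′ = T≡S , λ S′ → rise (subst (λ st → Run (suc y) st q _ _ _) (++-assoc (push (suc y)) (x ∷ X) S′) (R′ S′))

    -- Rotation order and componentwise order.

    rotation-raises : ∀ {μ μ′ b b′} → Rotation ν μ μ′ → Complete μ b → Complete μ′ b′ → ∀ k → b k ≤ b′ k
    rotation-raises {b = b} {b′} rot (completes R r) (completes R′ r′) k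
      with record { p = p ; q = q ; r = s ; before = refl ; after = refl ; horizW = hW ; next = nx } ← rot
      with y , _ , oₚ , _ , Rₚ , pop {j = j} {st = S} (rise R₂) , refl ← run-split p R
      with y₂ , T , o_q , o_s , R_q , R_s , refl ← run-split q R₂
      -- Horizontal distance is stack size, so the choice of W says that `q` first brings the stack
      -- back to the size of `S` at its very end.
      with refl , frame ← reframe (push (suc y)) {S} R_q
             (trans (sym (horiz≡length (run-++ Rₚ (pop (rise R_q))))) (trans hW (horiz≡length (run-++ Rₚ (pop stop)))))
             (λ q₁ q₂ eq ne R₁ len → nx q₁ q₂ eq ne (trans (horiz≡length (run-++ Rₚ (pop (rise R₁))))
                (trans len (sym (horiz≡length (run-++ Rₚ (pop stop)))))))
      -- The rotated path makes the same excursion over `j ∷ S` and pops `j` only afterwards;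
      -- determinism identifies the resulting log with the given one.
      with _ , _ , refl ← run-det R′ (run-++ Rₚ (rise (run-++ (frame (j ∷ S)) (pop R_s))))
      with v , kv∈ ← popped R (h≤n k) (pending-start k)
      with ∈-++⁻ oₚ kv∈
    ... | inj₁ kv∈ₚ = ≤-reflexive (trans (r kv∈) (sym (r′ (∈-++⁺ˡ kv∈ₚ))))
    -- This is the moved east step: `j` is now popped at the height of W instead of that of the
    -- valley.
    ... | inj₂ (here refl) = subst₂ _≤_ (sym (r kv∈)) (sym (r′ (∈-++⁺ʳ oₚ (∈-++⁺ʳ o_q (here refl))))) (<⇒≤ (run-height R_q))
    ... | inj₂ (there kv∈′) with ∈-++⁻ o_q kv∈′
    ...   | inj₁ kv∈q = ≤-reflexive (trans (r kv∈) (sym (r′ (∈-++⁺ʳ oₚ (∈-++⁺ˡ kv∈q)))))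
    ...   | inj₂ kv∈s = ≤-reflexive (trans (r kv∈) (sym (r′ (∈-++⁺ʳ oₚ (∈-++⁺ʳ o_q (there kv∈s))))))

    complete-unique : ∀ {μ b b′} → Complete μ b → Complete μ b′ → ∀ k → b k ≡ b′ k
    complete-unique (completes R r) (completes R′ r′) k with refl ← proj₂ (proj₂ (run-det R R′))
      with v , kv∈ ← popped R (h≤n k) (pending-start k) = trans (r kv∈) (sym (r′ kv∈))

    ≤ᵣ⇒code-≤ : ∀ {μ μ′ b b′} → ν ⊢ μ ≤ᵣ μ′ → Complete μ b → Complete μ′ b′ → ∀ k → b k ≤ b′ k
    ≤ᵣ⇒code-≤ ε          c c′ k = ≤-reflexive (complete-unique c c′ k)
    ≤ᵣ⇒code-≤ (rot ◅ rs) c c′ k with ∈𝓛⇒complete (Rotation.μ′∈𝓛 rot)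
    ... | b₁ , c₁ = ≤-trans (rotation-raises rot c c₁ k) (≤ᵣ⇒code-≤ rs c₁ c′ k)

    -- The excursion `to` is available over every `S′` because a rotation replays it over `j ∷ S`,
    -- while `from` continues over `S`.
    record FirstReturn (b : Fin n → ℕ) (z y : ℕ) (X S : List (Fin n)) (p : Path) (o : Log) : Set where
      field
        q r     : Path
        yW      : ℕ
        o₁ o₂   : Log
        path    : p ≡ q ++ r
        log     : o ≡ o₁ ++ o₂
        to      : ∀ S′ → Run y (X ++ S′) q yW S′ o₁
        from    : Run yW S r n [] o₂
        yW≤z    : yW ≤ z
        between : ∀ q₁ q₂ → q ≡ q₁ ++ q₂ → q₂ ≢ [] →
                  ∃[ y₁ ] ∃[ T₁ ] ∃[ o′ ] Run y (X ++ S) q₁ y₁ T₁ o′ × length S < length T₁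

    longer : ∀ (x : Fin n) X S → length S < length (x ∷ X ++ S)
    longer x X S = s≤s (subst (length S ≤_) (sym (length-++ X)) (m≤n+m _ (length X)))

    -- The bound `z` survives each north step: an entry of `X` still on the stack has value at least
    -- `suc y` and at most `z`, so the newly pushed positions have height at most `z` and the last
    -- hypothesis bounds their values.
    first-return : ∀ {b z} y X S {p o} → Run y (X ++ S) p n [] o → Realises b o → y ≤ z →
      (∀ {k} → k ∈ X → b k ≤ z) → (∀ {k} → y < h k → h k ≤ z → b k ≤ z) → FirstReturn b z y X S p o
    first-return y [] S R r y≤z _ _ = record
      { q = [] ; path = refl ; log = refl ; to = λ _ → stop ; from = R ; yW≤z = y≤z
      ; between = λ { [] [] _ ne → ⊥-elim (ne refl) } }
    first-return y (x ∷ X) S {E ∷ p} (pop {o = o} R) r y≤z X≤z later≤z = record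
      { q = E ∷ q ; path = cong (E ∷_) path ; log = cong (_ ∷_) log ; to = λ S′ → pop (to S′) ; from = from ; yW≤z = yW≤z
      ; between = between′ }
      where
      open FirstReturn (first-return y X S R (r ∘ there) y≤z (X≤z ∘ there) later≤z)
      between′ : ∀ q₁ q₂ → E ∷ q ≡ q₁ ++ q₂ → q₂ ≢ [] →
                 ∃[ y₁ ] ∃[ T₁ ] ∃[ o′ ] Run y (x ∷ X ++ S) q₁ y₁ T₁ o′ × length S < length T₁
      between′ []       _  _  _  = _ , _ , _ , stop , longer x X S
      between′ (_ ∷ q₁) q₂ eq ne with refl , eq′ ← ∷-injective eq =
        let _ , _ , _ , R₁ , lt = between q₁ q₂ eq′ ne in _ , _ , _ , pop R₁ , lt
    first-return {b} {z} y (x ∷ X) S {N ∷ p} (rise R) r y≤z X≤z later≤z = record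
      { q = N ∷ q ; path = cong (N ∷_) path ; log = log ; to = λ S′ → rise (regroup S′ (to S′)) ; from = from ; yW≤z = yW≤z
      ; between = between′ }
      where
      new = push (suc y)
      regroup : ∀ S′ {q y′ T o} → Run (suc y) ((new ++ x ∷ X) ++ S′) q y′ T o → Run (suc y) (new ++ x ∷ X ++ S′) q y′ T o
      regroup S′ = subst (λ st → Run (suc y) st _ _ _ _) (++-assoc new (x ∷ X) S′)
      y<z : suc y ≤ z
      y<z = ≤-trans (stack-≥ (completes R r) (∈-++⁺ʳ new (here refl))) (X≤z (here refl))
      X≤z′ : ∀ {k} → k ∈ new ++ x ∷ X → b k ≤ z
      X≤z′ {k} k∈ with ∈-++⁻ new k∈
      ... | inj₁ k∈new = later≤z (≤-reflexive (sym (∈-push⁻ (suc y) k∈new))) (≤-trans (≤-reflexive (∈-push⁻ (suc y) k∈new)) y<z)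
      ... | inj₂ k∈X   = X≤z k∈X
      open FirstReturn (first-return (suc y) (new ++ x ∷ X) S
        (subst (λ st → Run (suc y) st p n [] _) (sym (++-assoc new (x ∷ X) S)) R) r y<z X≤z′ (λ lt → later≤z (<⇒≤ lt)))
      between′ : ∀ q₁ q₂ → N ∷ q ≡ q₁ ++ q₂ → q₂ ≢ [] →
                 ∃[ y₁ ] ∃[ T₁ ] ∃[ o′ ] Run y (x ∷ X ++ S) q₁ y₁ T₁ o′ × length S < length T₁
      between′ []       _  _  _  = _ , _ , _ , stop , longer x X S
      between′ (_ ∷ q₁) q₂ eq ne with refl , eq′ ← ∷-injective eq =
        let _ , _ , _ , R₁ , lt = between q₁ q₂ eq′ ne in _ , _ , _ , rise (regroup S R₁) , lt

    module _ {b′ : Fin n → ℕ} (isCode : IsCode h b′) where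
      open IsCode isCode

      record RisingValley (y : ℕ) (st : List (Fin n)) (p : Path) (o : Log) : Set where
        field
          p₁ p₂ : Path
          j     : Fin n
          S     : List (Fin n)
          yV    : ℕ
          o₁ o₂ : Log
          path  : p ≡ p₁ ++ E ∷ N ∷ p₂
          log   : o ≡ o₁ ++ (j , yV) ∷ o₂
          to    : Run y st p₁ yV (j ∷ S) o₁
          from  : Run (suc yV) (push (suc yV) ++ S) p₂ n [] o₂
          below : yV < b′ j

      -- If the step after a deficient east step is again east, the position it pops lies below on
      -- the stack, and the code condition on b′ makes it deficient too.
      find-valley : ∀ {y st p o k v} → Run y st p n [] o → Ordered y st → (∀ {i u} → (i , u) ∈ o → u ≤ b′ i) →
                    (k , v) ∈ o → v < b′ k → RisingValley y st p o
      find-valley (rise R) od le k∈ lt = record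
        { path = cong (N ∷_) path ; log = log ; to = rise to ; from = from ; below = below }
        where open RisingValley (find-valley R (ordered-rise od) le k∈ lt)
      find-valley (pop stop) od le (here refl) lt = ⊥-elim (<⇒≱ lt (upper _))
      find-valley (pop (rise R)) od le (here refl) lt = record
        { p₁ = [] ; path = refl ; log = refl ; to = stop ; from = R ; below = lt }
      find-valley {y} {j ∷ i ∷ _} (pop (pop R)) od le (here refl) lt = record
        { path = cong (E ∷_) path ; log = cong (_ ∷_) log ; to = pop to ; from = from ; below = below }
        where
        j≤i : Above j i → b′ j ≤ b′ i
        j≤i (inj₁ hi<hj)       = across hi<hj (≤-trans (All.head (Ordered.bounded od)) (le (there (here refl))))
        j≤i (inj₂ (hj≡hi , lt)) = within lt hj≡hi
        head-above : ∀ {x z zs} → AllPairs Above (x ∷ z ∷ zs) → Above x z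
        head-above ((a ∷ _) ∷ _) = a
        open RisingValley (find-valley (pop R) (ordered-pop od) (le ∘ there) (here refl)
          (<-≤-trans lt (j≤i (head-above (Ordered.sorted od)))))
      find-valley (pop R) od le (there k∈) lt = record
        { path = cong (E ∷_) path ; log = cong (_ ∷_) log ; to = pop to ; from = from ; below = below }
        where open RisingValley (find-valley R (ordered-pop od) (le ∘ there) k∈ lt)

      -- The rotation cannot overshoot. Positions pushed after the valley have heights above `h j`;
      -- while these stay at most `b′ j`, `across` bounds their target values, hence their current
      -- ones, by `b′ j`. So `first-return` applies with `z = b′ j`, and the height of the return is
      -- the new value of `j`.
      rotate-towards : ∀ {μ b k} → Complete μ b → (∀ i → b i ≤ b′ i) → b k < b′ k →
        ∃[ μ″ ] ∃[ b″ ] Rotation ν μ μ″ × Complete μ″ b″ × (∀ i → b i ≤ b″ i) × (∀ i → b″ i ≤ b′ i) × ∃[ j ] b j < b″ j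
      rotate-towards {μ} {b} {k} (completes R r) b≤b′ b<b′
        with v , kv∈ ← popped R (h≤n k) (pending-start k)
        with record { p₁ = p₁ ; p₂ = p₂ ; j = j ; S = S ; yV = yV ; o₁ = o₁ ; path = refl ; log = refl
                  ; to = to₁ ; from = from₁ ; below = below }
               ← find-valley R ordered-start (λ i∈ → subst (_≤ b′ _) (r i∈) (b≤b′ _)) kv∈ (subst (_< b′ k) (r kv∈) b<b′)
        with record { q = q ; r = s ; yW = yW ; o₁ = oq ; o₂ = os ; path = refl ; log = refl
                  ; to = to₂ ; from = from₂ ; yW≤z = yW≤z ; between = between }
               ← first-return {b} {b′ j} (suc yV) (push (suc yV)) S from₁ (r ∘ ∈-++⁺ʳ o₁ ∘ there) below
                   (λ {i} i∈ → ≤-trans (b≤b′ i) (across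
                    (≤-trans (s≤s (All.head (Ordered.bounded (run-ordered to₁ ordered-start)))) (≤-reflexive (sym (∈-push⁻ (suc yV) i∈))))
                      (≤-trans (≤-reflexive (∈-push⁻ (suc yV) i∈)) below)))
                   (λ {i} lt hi≤ → ≤-trans (b≤b′ i) (across
                    (≤-<-trans (All.head (Ordered.bounded (run-ordered to₁ ordered-start))) (<-trans (n<1+n yV) lt)) hi≤))
        = _ , b″ , rotation , completes R″ r″ , b≤b″ , b″≤b′ , j , bj<
        where
        R″ : FullRun (p₁ ++ N ∷ q ++ E ∷ s) (o₁ ++ oq ++ (j , yW) ∷ os)
        R″ = run-++ to₁ (rise (run-++ (to₂ (j ∷ S)) (pop from₂)))
        b″ : Fin n → ℕ
        b″ = proj₁ (realisation R″ ordered-start)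
        r″ : Realises b″ (o₁ ++ oq ++ (j , yW) ∷ os)
        r″ = proj₂ (realisation R″ ordered-start)
        rotation : Rotation ν (p₁ ++ E ∷ N ∷ q ++ s) (p₁ ++ N ∷ q ++ E ∷ s)
        rotation = record
          { μ∈𝓛 = fullRun⇒∈𝓛 R ; μ′∈𝓛 = fullRun⇒∈𝓛 R″
          ; p = p₁ ; q = q ; r = s ; before = refl ; after = refl
          ; horizW = trans (horiz≡length (run-++ to₁ (pop (rise (to₂ S))))) (sym (horiz≡length (run-++ to₁ (pop stop))))
          ; next = λ q₁ q₂ eq ne e → let _ , _ , _ , R₁ , lt = between q₁ q₂ eq ne in
              <-irrefl (trans (sym (horiz≡length (run-++ to₁ (pop stop))))
              (trans (sym e) (horiz≡length (run-++ to₁ (pop (rise R₁)))))) lt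
          }
        b≤b″ : ∀ i → b i ≤ b″ i
        b≤b″ = rotation-raises rotation (completes R r) (completes R″ r″)
        bj< : b j < b″ j
        bj< = subst₂ _<_ (sym (r (∈-++⁺ʳ o₁ (here refl)))) (sym (r″ (∈-++⁺ʳ o₁ (∈-++⁺ʳ oq (here refl))))) (run-height (to₂ S))
        b″≤b′ : ∀ i → b″ i ≤ b′ i
        b″≤b′ i with popped R″ (h≤n i) (pending-start i)
        ... | v , iv∈ with ∈-++⁻ o₁ iv∈
        ... | inj₁ iv∈₁ = ≤-trans (≤-reflexive (trans (r″ iv∈) (sym (r (∈-++⁺ˡ iv∈₁))))) (b≤b′ i)
        ... | inj₂ iv∈₂ with ∈-++⁻ oq iv∈₂
        ...   | inj₁ iv∈q          = ≤-trans (≤-reflexive (trans (r″ iv∈) (sym (r (∈-++⁺ʳ o₁ (there (∈-++⁺ˡ iv∈q))))))) (b≤b′ i)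
        ...   | inj₂ (here refl)   = ≤-trans (≤-reflexive (r″ iv∈)) yW≤z
        ...   | inj₂ (there iv∈s)  = ≤-trans (≤-reflexive (trans (r″ iv∈) (sym (r (∈-++⁺ʳ o₁ (there (∈-++⁺ʳ oq iv∈s))))))) (b≤b′ i)

      gap : (Fin n → ℕ) → ℕ
      gap b = sum (map (λ i → b′ i ∸ b i) (allFin n))

      -- Recursion on a bound for the total deficit, which every chosen rotation lowers. With no
      -- deficit left the vectors agree, and so do the paths.
      climb : ∀ m {μ μ′ b} → gap b < m → Complete μ b → Complete μ′ b′ → (∀ i → b i ≤ b′ i) → ν ⊢ μ ≤ᵣ μ′
      climb (suc m) {μ} {μ′} {b} gap<m c c′ b≤b′ with Finₚ.any? (λ i → b i <? b′ i)
      ... | yes (k , lt) with rotate-towards c b≤b′ lt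
      ...   | μ″ , b″ , rot , c″ , b≤b″ , b″≤b′ , j , bj< =
        rot ◅ climb m (<-≤-trans
              (sum-map-< (λ i → ∸-monoʳ-≤ (b′ i) (b≤b″ i)) (∈-allFin j) (∸-monoʳ-< bj< (b″≤b′ j))) (≤-pred gap<m))
                c″ c′ b″≤b′
      climb (suc m) {μ} gap<m c c′ b≤b′ | no ¬lt
        = subst (ν ⊢ μ ≤ᵣ_) (completes-path-unique c c′ (λ i → ≤-antisym (b≤b′ i) (≮⇒≥ (λ lt → ¬lt (i , lt))))) ε

      code-≤⇒≤ᵣ : ∀ {μ μ′ b} → Complete μ b → Complete μ′ b′ → (∀ i → b i ≤ b′ i) → ν ⊢ μ ≤ᵣ μ′
      code-≤⇒≤ᵣ = climb _ ≤-refl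

-- The facts about region ends on which the permutation arguments rest; `gap` expresses that regions
-- are consecutive intervals.
record IsRegionEnd {n} (h : Fin n → ℕ) : Set where
  field
    self  : ∀ i → pos i ≤ h i
    bound : ∀ i → h i ≤ n
    gap   : ∀ {i j} → h i < h j → h i < pos j

  mono : ∀ {i j} → i <ᶠ j → h i ≤ h j
  mono {i} {j} i<j = ≮⇒≥ λ hj<hi → <-asym i<j (≤-pred (≤-trans (s≤s (self j)) (gap hj<hi)))

  inside : ∀ {i j} → h i < pos j → h i < h j
  inside {j = j} lt = <-≤-trans lt (self j)

-- Regions and the bounce path

end : List ℕ → ℕ → ℕ
end as p = partialSum as (regionOf as p)

end-≤ : ∀ as p p′ → p′ ≤ end as p → end as p′ ≤ end as p
end-≤ []       p p′ le = z≤n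
end-≤ (a ∷ as) p p′ le with p′ ≤? a | p ≤? a
... | yes _   | yes _ = ≤-refl
... | yes _   | no _  = +-monoʳ-≤ a z≤n
... | no p′≰a | yes _ = ⊥-elim (p′≰a (subst (p′ ≤_) (+-identityʳ a) le))
... | no p′≰a | no _  = +-monoʳ-≤ a (end-≤ as (p ∸ a) (p′ ∸ a) (≤-trans (∸-monoˡ-≤ a le) (≤-reflexive (m+n∸m≡n a _))))

end-≤-sum : ∀ as k → partialSum as k ≤ sum as
end-≤-sum []       zero    = z≤n
end-≤-sum []       (suc k) = z≤n
end-≤-sum (a ∷ as) zero    = z≤n
end-≤-sum (a ∷ as) (suc k) = +-monoʳ-≤ a (end-≤-sum as k)

-- Code vectors see regions through their ends, while permutations and patterns refer to region
-- indices; this translates back. A first-block position sharing its end with a later one would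
-- force a partial sum to vanish that `regionOf-spec` makes positive.
end-injective : ∀ as p p′ → 0 < p → 0 < p′ → p ≤ sum as → p′ ≤ sum as →
                end as p ≡ end as p′ → regionOf as p ≡ regionOf as p′
end-injective []       p p′ 0<p 0<p′ p≤ p′≤ e = refl
end-injective (a ∷ as) p p′ 0<p 0<p′ p≤ p′≤ e with p ≤? a | p′ ≤? a
... | yes _  | yes _   = refl
... | yes _  | no p′≰a = ⊥-elim (<-irrefl (+-cancelˡ-≡ a _ _ e) (<-≤-trans (m<n⇒0<n∸m (≰⇒> p′≰a))
                           (proj₂ (regionOf-spec as (p′ ∸ a) (m<n⇒0<n∸m (≰⇒> p′≰a)) (m≤n+o⇒m∸n≤o p′ a p′≤)))))
... | no p≰a | yes _   = ⊥-elim (<-irrefl (sym (+-cancelˡ-≡ a _ _ e)) (<-≤-trans (m<n⇒0<n∸m (≰⇒> p≰a))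
                           (proj₂ (regionOf-spec as (p ∸ a) (m<n⇒0<n∸m (≰⇒> p≰a)) (m≤n+o⇒m∸n≤o p a p≤)))))
... | no p≰a | no p′≰a = cong suc (end-injective as (p ∸ a) (p′ ∸ a) (m<n⇒0<n∸m (≰⇒> p≰a)) (m<n⇒0<n∸m (≰⇒> p′≰a))
                           (m≤n+o⇒m∸n≤o p a p≤) (m≤n+o⇒m∸n≤o p′ a p′≤) (+-cancelˡ-≡ a _ _ e))

module _ {n} (α : Composition n) where

  regionEnd : Fin n → ℕ
  regionEnd i = s α (ϱ α i)

  private
    pos≤sum : ∀ i → pos i ≤ sum (parts α)
    pos≤sum i = subst (pos i ≤_) (sym (sums α)) (toℕ<n i)

  regionEnd-isRegionEnd : IsRegionEnd regionEnd
  regionEnd-isRegionEnd = record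
    { self  = λ i → proj₂ (regionOf-spec (parts α) (pos i) (s≤s z≤n) (pos≤sum i))
    ; bound = λ i → subst (regionEnd i ≤_) (sums α) (end-≤-sum (parts α) (ϱ α i))
    ; gap   = λ {i} {j} lt → ≰⇒> λ le → <⇒≱ lt (end-≤ (parts α) (pos i) (pos j) le)
    }

  regionEnd-injective : ∀ {i j} → regionEnd i ≡ regionEnd j → ϱ α i ≡ ϱ α j
  regionEnd-injective {i} {j} = end-injective (parts α) (pos i) (pos j) (s≤s z≤n) (s≤s z≤n) (pos≤sum i) (pos≤sum j)

endpoint-++ : ∀ p q → endpoint (p ++ q) ≡ (proj₁ (endpoint p) + proj₁ (endpoint q) , proj₂ (endpoint p) + proj₂ (endpoint q))
endpoint-++ []      q = refl
endpoint-++ (E ∷ p) q = cong (map₁ suc) (endpoint-++ p q)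
endpoint-++ (N ∷ p) q = cong (map₂ suc) (endpoint-++ p q)

endpoint-E : ∀ a → endpoint (replicate a E) ≡ (a , 0)
endpoint-E zero    = refl
endpoint-E (suc a) = cong (map₁ suc) (endpoint-E a)

endpoint-N : ∀ a → endpoint (replicate a N) ≡ (0 , a)
endpoint-N zero    = refl
endpoint-N (suc a) = cong (map₂ suc) (endpoint-N a)

bounce : List ℕ → Path
bounce = concatMap (λ a → replicate a N ++ replicate a E)

endpoint-bounce : ∀ as → endpoint (bounce as) ≡ (sum as , sum as)
endpoint-bounce []       = refl
endpoint-bounce (a ∷ as)
  rewrite endpoint-++ (replicate a N ++ replicate a E) (bounce as) | endpoint-++ (replicate a N) (replicate a E)
        | endpoint-E a | endpoint-N a | endpoint-bounce as | +-identityʳ a = refl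

rightmost-N< : ∀ {a y} ν → y < a → rightmost (replicate a N ++ ν) y ≡ 0
rightmost-N< {suc a} {zero}  ν _         = refl
rightmost-N< {suc a} {suc y} ν (s≤s y<a) = rightmost-N< ν y<a

rightmost-N≥ : ∀ {a y} ν → a ≤ y → rightmost (replicate a N ++ ν) y ≡ rightmost ν (y ∸ a)
rightmost-N≥ ν z≤n       = refl
rightmost-N≥ ν (s≤s a≤y) = rightmost-N≥ ν a≤y

rightmost-E : ∀ a ν y → rightmost (replicate a E ++ ν) y ≡ a + rightmost ν y
rightmost-E zero    ν y = refl
rightmost-E (suc a) ν y = cong suc (rightmost-E a ν y)

length-filter-map : ∀ {A B : Set} {P : B → Set} (P? : Decidable P) (g : A → B) xs →
                    length (filter P? (map g xs)) ≡ length (filter (P? ∘ g) xs)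
length-filter-map P? g [] = refl
length-filter-map P? g (x ∷ xs) with P? (g x)
... | yes _ = cong suc (length-filter-map P? g xs)
... | no  _ = length-filter-map P? g xs

length-filter-cong : ∀ {A : Set} {P Q : A → Set} (P? : Decidable P) (Q? : Decidable Q) →
                     (∀ {x} → P x → Q x) → (∀ {x} → Q x → P x) → ∀ xs → length (filter P? xs) ≡ length (filter Q? xs)
length-filter-cong P? Q? PQ QP xs = cong length (filter-≐ P? Q? (PQ , QP) xs)

tabulate-+ : ∀ {A : Set} a {m} (g : Fin (a + m) → A) →
             List.tabulate g ≡ List.tabulate (g ∘ (_↑ˡ m)) ++ List.tabulate (g ∘ (a ↑ʳ_))
tabulate-+ zero    g = refl
tabulate-+ (suc a) g = cong (_ ∷_) (tabulate-+ a (g ∘ Fin.suc))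

-- Prefixing a part `a` adds `a` positions that end at `a` and shifts all later ends by `a`;
-- prefixing the path with `a` north and `a` east steps lifts and widens it accordingly.
count-ends : ∀ as y → length (filter (λ j → end as (pos j) ≤? y) (allFin (sum as))) ≡ rightmost (bounce as) y
count-ends []       y = refl
count-ends (a ∷ as) y = begin
  length (filter Q? (allFin (a + sum as)))      ≡⟨ cong (length ∘ filter Q?) (tabulate-+ a id) ⟩
  length (filter Q? (here? ++ later))           ≡⟨ cong length (filter-++ Q? here? later) ⟩
  length (filter Q? here? ++ filter Q? later)   ≡⟨ length-++ (filter Q? here?) ⟩
  length (filter Q? here?) + length (filter Q? later) ≡⟨ cong (length (filter Q? here?) +_) later≡ ⟩
  length (filter Q? here?) + length (filter (λ j → a + end as (pos j) ≤? y) (allFin (sum as))) ≡⟨ split (a ≤? y) ⟩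
  rightmost (bounce (a ∷ as)) y ∎
  where
  open ≡-Reasoning
  Q? : (j : Fin (a + sum as)) → Dec (end (a ∷ as) (pos j) ≤ y)
  Q? j = end (a ∷ as) (pos j) ≤? y
  here? later : List (Fin (a + sum as))
  here? = List.tabulate (_↑ˡ sum as)
  later = List.tabulate (a ↑ʳ_)
  end-here : ∀ (i : Fin a) → end (a ∷ as) (pos (i ↑ˡ sum as)) ≡ a
  end-here i with pos (i ↑ˡ sum as) ≤? a
  ... | yes _ = +-identityʳ a
  ... | no ne = ⊥-elim (ne (subst (_≤ a) (cong suc (sym (Finₚ.toℕ-↑ˡ i (sum as)))) (toℕ<n i)))
  end-later : ∀ (i : Fin (sum as)) → end (a ∷ as) (pos (a ↑ʳ i)) ≡ a + end as (pos i)
  end-later i with pos (a ↑ʳ i) ≤? a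
  ... | yes le = ⊥-elim (<⇒≱ (subst (λ z → a < suc z) (sym (Finₚ.toℕ-↑ʳ a i)) (s≤s (m≤m+n a (toℕ i)))) le)
  ... | no _ rewrite Finₚ.toℕ-↑ʳ a i | sym (+-suc a (toℕ i)) | m+n∸m≡n a (pos i) = refl
  later≡ : length (filter Q? later) ≡ length (filter (λ j → a + end as (pos j) ≤? y) (allFin (sum as)))
  later≡ = trans (cong (length ∘ filter Q?) (sym (map-tabulate id (a ↑ʳ_))))
    (trans (length-filter-map Q? (a ↑ʳ_) (allFin (sum as)))
      (length-filter-cong (Q? ∘ (a ↑ʳ_)) (λ j → a + end as (pos j) ≤? y)
        (λ {j} → subst (_≤ y) (end-later j)) (λ {j} → subst (_≤ y) (sym (end-later j))) (allFin (sum as))))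
  all-here : a ≤ y → All (λ j → end (a ∷ as) (pos j) ≤ y) here?
  all-here a≤y = Allₚ.tabulate⁺ λ i → subst (_≤ y) (sym (end-here i)) a≤y
  no-here : ¬ (a ≤ y) → All (λ j → ¬ (end (a ∷ as) (pos j) ≤ y)) here?
  no-here a≰y = Allₚ.tabulate⁺ λ i → a≰y ∘ subst (_≤ y) (end-here i)
  split : Dec (a ≤ y) → length (filter Q? here?) + length (filter (λ j → a + end as (pos j) ≤? y) (allFin (sum as)))
          ≡ rightmost (bounce (a ∷ as)) y
  split (yes a≤y) rewrite ++-assoc (replicate a N) (replicate a E) (bounce as) | rightmost-N≥ (replicate a E ++ bounce as) a≤y
      | rightmost-E a (bounce as) (y ∸ a) =
    cong₂ _+_ (trans (cong length (filter-all Q? (all-here a≤y))) (length-tabulate (_↑ˡ sum as)))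
      (trans (length-filter-cong (λ j → a + end as (pos j) ≤? y) (λ j → end as (pos j) ≤? y ∸ a)
          (m+n≤o⇒m≤o∸n _ ∘ ≤-trans (≤-reflexive (+-comm _ a)))
          (λ le → ≤-trans (+-monoʳ-≤ a le) (≤-reflexive (m+[n∸m]≡n a≤y))) (allFin (sum as)))
        (count-ends as (y ∸ a)))
  split (no a≰y) rewrite ++-assoc (replicate a N) (replicate a E) (bounce as) | rightmost-N< (replicate a E ++ bounce as) (≰⇒> a≰y)
      | filter-none Q? (no-here a≰y) =
    cong length (filter-none (λ j → a + end as (pos j) ≤? y) {allFin (sum as)} (All.tabulate λ _ le → a≰y (≤-trans (m≤m+n a _) le)))

module _ {n} (α : Composition n) where

  endpoint-bouncePath : endpoint (bouncePath α) ≡ (n , n)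
  endpoint-bouncePath = trans (endpoint-bounce (parts α)) (cong (λ z → z , z) (sums α))

  rightmost-bouncePath : ∀ y → rightmost (bouncePath α) y ≡ length (filter (λ j → regionEnd α j ≤? y) (allFin n))
  rightmost-bouncePath y = sym (go (sums α))
    where
    -- The size is generalised to `m` so that the equation `sums α` can be matched with `refl`.
    go : ∀ {m} → sum (parts α) ≡ m →
         length (filter (λ j → end (parts α) (pos j) ≤? y) (allFin m)) ≡ rightmost (bouncePath α) y
    go refl = count-ends (parts α) y

-- Permutations and their codes

module _ {P : ℕ → Set} (P? : Decidable P) where

  largest-holds : P 0 → ∀ m → P (largest P? m)
  largest-holds P0 zero = P0
  largest-holds P0 (suc m) with P? (suc m)
  ... | yes p = p
  ... | no  _ = largest-holds P0 m

  largest-max : ∀ m {k} → k ≤ m → P k → k ≤ largest P? m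
  largest-max zero    k≤ pk = k≤
  largest-max (suc m) k≤ pk with P? (suc m)
  ... | yes _ = k≤
  ... | no ¬p = largest-max m (≤-pred (≤∧≢⇒< k≤ λ { refl → ¬p pk })) pk

module Codes {n} {α : Composition n} where

  h : Fin n → ℕ
  h = regionEnd α

  open IsRegionEnd (regionEnd-isRegionEnd α)

  index : ∀ {k} → k < n → ∃[ m ] pos m ≡ suc k
  index k<n = fromℕ< k<n , cong suc (toℕ-fromℕ< k<n)

  t : 𝔖 α → Fin n → ℕ
  t w i = code {α = α} w i + h i

  val : 𝔖 α → Fin n → ℕ
  val w i = toℕ (perm w ⟨$⟩ʳ i)

  val-injective : ∀ w {i j} → val w i ≡ val w j → i ≡ j
  val-injective w {i} {j} e = trans (sym (inverseˡ (perm w)))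
    (trans (cong (perm w ⟨$⟩ˡ_) (toℕ-injective e)) (inverseˡ (perm w)))

  val-onto : ∀ w k → k < n → ∃[ i ] val w i ≡ k
  val-onto w k k<n = perm w ⟨$⟩ˡ fromℕ< k<n , trans (cong toℕ (inverseʳ (perm w))) (toℕ-fromℕ< k<n)

  region-increasing : ∀ w {i j} → i <ᶠ j → h i ≡ h j → val w i < val w j
  region-increasing w {i} {j} i<j e = go (toℕ j) i<j e refl
    where
    go : ∀ k {j} → i <ᶠ j → h i ≡ h j → toℕ j ≡ k → val w i < val w j
    go zero    {j} i<j e j≡ = ⊥-elim (n≮0 (subst (toℕ i <_) j≡ i<j))
    go (suc k) {j} i<j e j≡ with index {k} (<-trans (n<1+n k) (subst (_< n) j≡ (toℕ<n j)))
    ... | j′ , j′≡ with toℕ i ≟ k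
    ...   | yes i≡k = increasing w i j (trans (cong suc j≡) (cong (suc ∘ suc) (sym i≡k))) (regionEnd-injective α e)
    ...   | no  i≢k = <-trans (go k i<j′ (sym hj′≡) (suc-injective j′≡))
                        (increasing w j′ j (trans (cong suc j≡) (cong suc (sym j′≡))) (regionEnd-injective α (trans hj′≡ e)))
      where
      i<j′ : i <ᶠ j′
      i<j′ = ≤∧≢⇒< (≤-pred (subst (suc (toℕ i) ≤_) (trans j≡ (sym j′≡)) i<j)) (λ e′ → i≢k (trans e′ (suc-injective j′≡)))
      hj′≡ : h j′ ≡ h i
      hj′≡ = ≤-antisym (≤-trans (mono (≤-reflexive (trans j′≡ (sym j≡)))) (≤-reflexive (sym e))) (mono i<j′)

  code-dominates : ∀ w i → DominatesNext {α = α} w i (code {α = α} w i)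
  code-dominates w i = largest-holds (dominatesNext? {α = α} w i)
    -- Length 0 always qualifies: no position is both past `h i` and at most `h i`.
    (subst (_≤ n) (sym (+-identityʳ (h i))) (bound i) , λ j lt le → ⊥-elim (<⇒≱ lt (subst (pos j ≤_) (+-identityʳ (h i)) le))) n

  t-upper : ∀ w i → t w i ≤ n
  t-upper w i = subst (_≤ n) (+-comm (h i) (code {α = α} w i)) (proj₁ (code-dominates w i))

  t-lower : ∀ w i → h i ≤ t w i
  t-lower w i = m≤n+m (h i) (code {α = α} w i)

  t-dominates : ∀ w {i j} → h i < pos j → pos j ≤ t w i → val w j < val w i
  t-dominates w {i} {j} lt le = proj₂ (code-dominates w i) j lt (subst (pos j ≤_) (+-comm (code {α = α} w i) (h i)) le)

  t-maximal : ∀ w {i} → t w i < n → ∃[ m ] pos m ≡ suc (t w i) × val w i < val w m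
  t-maximal w {i} t<n with index t<n
  ... | m , m≡ = m , m≡ , ≤∧≢⇒< (≮⇒≥ m≮i) i≢m
    where
    m≮i : ¬ (val w m < val w i)
    m≮i m<i = 1+n≰n (largest-max (dominatesNext? {α = α} w i) n
      (≤-trans (s≤s (m≤m+n (code {α = α} w i) (h i))) t<n)
      (subst (_≤ n) (trans (cong suc (+-comm (code {α = α} w i) (h i))) (sym (+-suc (h i) (code {α = α} w i)))) t<n , dom))
      where
      dom : ∀ j → h i < pos j → pos j ≤ h i + suc (code {α = α} w i) → val w j < val w i
      dom j lt le with pos j ≟ suc (t w i)
      ... | yes e = subst (λ k → val w k < val w i) (toℕ-injective (suc-injective (trans m≡ (sym e)))) m<i
      ... | no ne = t-dominates w lt (≤-pred (≤∧≢⇒<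
        (subst (pos j ≤_) (trans (+-suc (h i) (code {α = α} w i)) (cong suc (+-comm (h i) (code {α = α} w i)))) le) ne))
    i≢m : val w i ≢ val w m
    i≢m e = <-irrefl (cong pos (val-injective w e)) (subst (pos i <_) (sym m≡) (s≤s (≤-trans (self i) (t-lower w i))))

  h<next : ∀ w {i} {m : Fin n} → pos m ≡ suc (t w i) → h i < pos m
  h<next w {i} m≡ = subst (h i <_) (sym m≡) (s≤s (t-lower w i))

  -- If a condition failed, the position just past the smaller of `t w i` and `t w j` would have a
  -- value above that of its own blocker's victim and below that of the other position, giving a
  -- cycle of strict inequalities among three values.
  t-isCode : ∀ w → IsCode h (t w)
  t-isCode w = record { lower = t-lower w ; upper = t-upper w ; within = within ; across = across }
    where
    within : ∀ {i j} → i <ᶠ j → h i ≡ h j → t w i ≤ t w j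
    within {i} {j} i<j e = ≮⇒≥ λ tj<ti → let m , m≡ , vj<vm = t-maximal w (<-≤-trans tj<ti (t-upper w i)) in
      <-asym (region-increasing w i<j e)
        (<-trans vj<vm (t-dominates w (subst (_< pos m) (sym e) (h<next w m≡)) (subst (_≤ t w i) (sym m≡) tj<ti)))
    across : ∀ {i j} → h i < h j → h j ≤ t w i → t w j ≤ t w i
    across {i} {j} hi<hj hj≤ = ≮⇒≥ λ ti<tj → let m , m≡ , vi<vm = t-maximal w (<-≤-trans ti<tj (t-upper w j)) in
      <-asym vi<vm (<-trans (t-dominates w {j} {m} (subst (h j <_) (sym m≡) (s≤s hj≤)) (subst (_≤ t w j) (sym m≡) ti<tj))
                            (t-dominates w (gap hi<hj) (≤-trans (self j) hj≤)))

  -- If `t v i` were smaller, the position just past it would form an inversion with `i` in `u` but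
  -- not in `v`.
  ≤L⇒t-≤ : ∀ u v → _≤L_ {α = α} u v → ∀ i → t u i ≤ t v i
  ≤L⇒t-≤ u v u≤v i = ≮⇒≥ λ tv<tu → let m , m≡ , vi<vm = t-maximal v (<-≤-trans tv<tu (t-upper u i)) in
    <-asym vi<vm (proj₂ (u≤v ( ≤-pred (≤-<-trans (self i) (h<next v m≡))
                             , t-dominates u (h<next v m≡) (subst (_≤ t u i) (sym m≡) tv<tu))))

  -- Walking up by value from j to i, the first value not right of m's region lies inside it,
  -- as otherwise it would complete a pattern with middle element m.
  between-value : ∀ u → ¬ Pattern231 {α = α} u → ∀ {i m j} → h i < h m → h m < h j → val u i < val u m → val u j < val u i →
                  ∃[ x ] h x ≡ h m × val u j < val u x × val u x < val u i
  between-value u av {i} {m} hi<hm hm<hj ui<um uj<ui = go (val u i) hm<hj uj<ui (m≤n+m _ _)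
    where
    before : ∀ {x y} → h x < h y → x <ᶠ y
    before {x} {y} lt = ≤-pred (≤-<-trans (self x) (gap lt))
    apart : ∀ {x y} → h x < h y → ϱ α x ≢ ϱ α y
    apart lt e = <-irrefl (cong (s α) e) lt
    go : ∀ d {j} → h m < h j → val u j < val u i → val u i ≤ val u j + d →
         ∃[ x ] h x ≡ h m × val u j < val u x × val u x < val u i
    go zero    {j} hm<hj uj<ui le = ⊥-elim (<⇒≱ uj<ui (subst (val u i ≤_) (+-identityʳ _) le))
    go (suc d) {j} hm<hj uj<ui le with val-onto u (suc (val u j)) (≤-<-trans uj<ui (toℕ<n (perm u ⟨$⟩ʳ i)))
    ... | x , ux≡ with <-cmp (h x) (h m)
    ...   | tri< hx<hm _ _ = ⊥-elim (av (record
      { i = x ; j = m ; k = j ; i<j = before hx<hm ; j<k = before hm<hj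
      ; ϱi≢ϱj = apart hx<hm ; ϱj≢ϱk = apart hm<hj ; ϱi≢ϱk = apart (<-trans hx<hm hm<hj)
      ; wi<wj = ≤-<-trans (subst (_≤ val u i) (sym ux≡) uj<ui) ui<um ; wi≡wk+1 = ux≡ }))
    ...   | tri≈ _ hx≡hm _ = x , hx≡hm , ≤-reflexive (sym ux≡) , ≤∧≢⇒< (subst (_≤ val u i) (sym ux≡) uj<ui)
      (λ e → <-irrefl (trans (cong h (val-injective u (sym e))) hx≡hm) hi<hm)
    ...   | tri> _ _ hm<hx with go d hm<hx
              (≤∧≢⇒< (subst (_≤ val u i) (sym ux≡) uj<ui) (λ e → <-asym hi<hm (subst (h m <_) (cong h (val-injective u e)) hm<hx)))
              (subst (val u i ≤_) (trans (+-suc _ d) (cong (_+ d) (sym ux≡))) le)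
    ...     | y , hy≡ , ux<uy , uy<ui = y , hy≡ , <-trans (≤-reflexive (sym ux≡)) ux<uy , uy<ui

  inversion-apart : ∀ u {i j} → i <ᶠ j → val u j < val u i → h i < h j
  inversion-apart u i<j uj<ui = ≤∧≢⇒< (mono i<j) (λ e → <-asym uj<ui (region-increasing u i<j e))

  -- Induction on the value of `i`. If `j` lies beyond `t u i`, the blocking position `m` and
  -- `between-value` give an `x` in the region of `m` whose value is between those of `j` and `i`.
  -- It lies left of `m`, hence within `t u i`, and the inversion factors through `x`.
  t-≤⇒≤L : ∀ u v → ¬ Pattern231 {α = α} u → (∀ i → t u i ≤ t v i) → _≤L_ {α = α} u v
  t-≤⇒≤L u v av tu≤tv {i , j} (i<j , uj<ui) = i<j , go (suc (val u i)) i<j uj<ui ≤-refl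
    where
    go : ∀ d {i j} → i <ᶠ j → val u j < val u i → val u i < d → val v j < val v i
    go (suc d) {i} {j} i<j uj<ui ui<d with pos j ≤? t u i | inversion-apart u i<j uj<ui
    ... | yes le | hi<hj = t-dominates v (gap hi<hj) (≤-trans le (tu≤tv i))
    ... | no nle | hi<hj with t-maximal u {i} (≤-trans (≰⇒> nle) (toℕ<n j))
    ...   | m , m≡ , ui<um = <-trans (go d x<j ujx (<-≤-trans uxi (≤-pred ui<d)))
                              (t-dominates v (gap hi<hx) (≤-trans x≤t (tu≤tv i)))
      where
      m≤j : pos m ≤ pos j
      m≤j = subst (_≤ pos j) (sym m≡) (≰⇒> nle)
      m<j : m <ᶠ j
      m<j = ≤∧≢⇒< (≤-pred m≤j) (λ e → <-irrefl (cong (val u) (toℕ-injective (sym e))) (<-trans uj<ui ui<um))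
      hi<hm : h i < h m
      hi<hm = inside (h<next u m≡)
      hm<hj : h m < h j
      hm<hj = inversion-apart u m<j (<-trans uj<ui ui<um)
      found = between-value u av hi<hm hm<hj ui<um uj<ui
      x = proj₁ found
      hx≡hm : h x ≡ h m
      hx≡hm = proj₁ (proj₂ found)
      ujx : val u j < val u x
      ujx = proj₁ (proj₂ (proj₂ found))
      uxi : val u x < val u i
      uxi = proj₂ (proj₂ (proj₂ found))
      hi<hx : h i < h x
      hi<hx = subst (h i <_) (sym hx≡hm) hi<hm
      x<m : x <ᶠ m
      x<m with Finₚ.<-cmp x m
      ... | tri< lt _ _  = lt
      ... | tri≈ _ e _   = ⊥-elim (<-asym ui<um (subst (λ k → val u k < val u i) e uxi))
      ... | tri> _ _ m<x = ⊥-elim (<-asym (<-trans uxi ui<um) (region-increasing u m<x (sym hx≡hm)))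
      x<j : x <ᶠ j
      x<j = <-trans x<m m<j
      x≤t : pos x ≤ t u i
      x≤t = ≤-pred (subst (pos x <_) m≡ (s≤s x<m))

-- A permutation from a decidable strict total order.

injective⇒surjective : ∀ {m} (g : Fin m → Fin m) → (∀ {i j} → g i ≡ g j → i ≡ j) → ∀ y → ∃[ x ] g x ≡ y
injective⇒surjective {suc m} g inj y with any? (λ x → g x Finₚ.≟ y)
... | yes found = found
-- Pigeonhole: missing `y`, the map could be squeezed injectively into a set with one element fewer.
... | no missed = ⊥-elim (1+n≰n (injective⇒≤ {f = λ x → punchOut {i = y} (λ e → missed (x , sym e))}
                    (λ {x} {x′} e → inj (punchOut-injective (λ e → missed (x , sym e)) (λ e → missed (x′ , sym e)) e))))

module _ {n} {_≺_ : Fin n → Fin n → Set} (_≺?_ : ∀ i j → Dec (i ≺ j))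
  (≺-irrefl : ∀ {i} → ¬ (i ≺ i)) (≺-trans : ∀ {i j k} → i ≺ j → j ≺ k → i ≺ k)
  (≺-total : ∀ {i j} → i ≢ j → i ≺ j ⊎ j ≺ i) where

  private
    below : Fin n → Fin n → ℕ
    below i j with j ≺? i
    ... | yes _ = 1
    ... | no  _ = 0

    rank : Fin n → ℕ
    rank i = sum (map (below i) (allFin n))

    below-refl : ∀ i → below i i ≡ 0
    below-refl i with i ≺? i
    ... | yes p = ⊥-elim (≺-irrefl p)
    ... | no  _ = refl

    below-≤1 : ∀ i j → below i j ≤ 1
    below-≤1 i j with j ≺? i
    ... | yes _ = ≤-refl
    ... | no  _ = z≤n

    below-≺ : ∀ {i j} → i ≺ j → below j i ≡ 1
    below-≺ {i} {j} p with i ≺? j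
    ... | yes _ = refl
    ... | no ¬p = ⊥-elim (¬p p)

    below-mono : ∀ {i j} → i ≺ j → ∀ k → below i k ≤ below j k
    below-mono {i} {j} p k with k ≺? i
    ... | yes q = ≤-reflexive (sym (below-≺ (≺-trans q p)))
    ... | no  _ = z≤n

    rank-mono : ∀ {i j} → i ≺ j → rank i < rank j
    rank-mono {i} {j} p = sum-map-< (below-mono p) (∈-allFin i)
      (subst₂ _<_ (sym (below-refl i)) (sym (below-≺ p)) ≤-refl)

    sum-ones : ∀ (xs : List (Fin n)) → sum (map (λ _ → 1) xs) ≡ length xs
    sum-ones []       = refl
    sum-ones (_ ∷ xs) = cong suc (sum-ones xs)

    rank<n : ∀ i → rank i < n
    rank<n i = subst (rank i <_) (trans (sum-ones (allFin n)) (length-tabulate {n = n} id))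
      (sum-map-< (below-≤1 i) (∈-allFin i) (subst (_< 1) (sym (below-refl i)) ≤-refl))

    rankᶠ : Fin n → Fin n
    rankᶠ i = fromℕ< (rank<n i)

    toℕ-rankᶠ : ∀ i → toℕ (rankᶠ i) ≡ rank i
    toℕ-rankᶠ i = toℕ-fromℕ< (rank<n i)

    rankᶠ-injective : ∀ {i j} → rankᶠ i ≡ rankᶠ j → i ≡ j
    rankᶠ-injective {i} {j} e with i Finₚ.≟ j
    ... | yes i≡j = i≡j
    ... | no  i≢j = ⊥-elim (ne (≺-total i≢j))
      where
      e′ : rank i ≡ rank j
      e′ = trans (sym (toℕ-rankᶠ i)) (trans (cong toℕ e) (toℕ-rankᶠ j))
      ne : i ≺ j ⊎ j ≺ i → ⊥
      ne (inj₁ p) = <-irrefl e′ (rank-mono p)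
      ne (inj₂ p) = <-irrefl (sym e′) (rank-mono p)

  abstract
    rankPermutation : Σ (Permutation′ n) λ π → ∀ {i j} → i ≺ j → (π ⟨$⟩ʳ i) <ᶠ (π ⟨$⟩ʳ j)
    rankPermutation = permutation rankᶠ inverse (λ y → proj₂ (onto y)) (λ x → rankᶠ-injective (proj₂ (onto (rankᶠ x))))
      , λ {i} {j} p → subst₂ _<_ (sym (toℕ-rankᶠ i)) (sym (toℕ-rankᶠ j)) (rank-mono p)
      where
      onto : ∀ y → ∃[ x ] rankᶠ x ≡ y
      onto = injective⇒surjective rankᶠ rankᶠ-injective
      inverse : Fin n → Fin n
      inverse y = proj₁ (onto y)

-- The pattern-avoiding permutation with a given code vector.

module FromCode {n} {α : Composition n} {t : Fin n → ℕ} (isCode : IsCode (regionEnd α) t) where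

  open Codes {α = α} hiding (t)
  open IsRegionEnd (regionEnd-isRegionEnd α)
  open IsCode isCode

  Covers : Fin n → Fin n → Set
  Covers i j = h i < pos j × pos j ≤ t i

  data Inverts : Fin n → Fin n → Set where
    last : ∀ {i j} → Covers i j → Inverts i j
    _∷_  : ∀ {i j k} → Covers i j → Inverts j k → Inverts i k

  inverts-h : ∀ {i j} → Inverts i j → h i < h j
  inverts-h (last (lt , _))  = inside lt
  inverts-h ((lt , _) ∷ r) = <-trans (inside lt) (inverts-h r)

  h⇒< : ∀ {i j} → h i < h j → i <ᶠ j
  h⇒< {i} lt = ≤-pred (≤-<-trans (self i) (gap lt))

  inverts-< : ∀ {i j} → Inverts i j → i <ᶠ j
  inverts-< r = h⇒< (inverts-h r)

  inverts-trans : ∀ {i j k} → Inverts i j → Inverts j k → Inverts i k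
  inverts-trans (last c) s = c ∷ s
  inverts-trans (c ∷ r)  s = c ∷ inverts-trans r s

  -- Inside a region t is increasing, so j covers whatever an earlier i of its region covers beyond it.
  covers-split : ∀ {i j k} → i <ᶠ j → j <ᶠ k → Covers i k → Covers i j ⊎ Covers j k
  covers-split {i} {j} {k} i<j j<k (lt , le) with h i ≟ h j
  ... | yes e = inj₂ (subst (_< pos k) e lt , ≤-trans le (within i<j e))
  ... | no ne = inj₁ (gap (≤∧≢⇒< (mono i<j) ne) , ≤-trans (<⇒≤ (s≤s j<k)) le)

  -- The contrapositive is transitivity of the non-inverted increasing pairs. Together with
  -- `inverts-trans` it characterises inversion sets of permutations.
  inverts-cotrans : ∀ {i j k} → i <ᶠ j → j <ᶠ k → Inverts i k → Inverts i j ⊎ Inverts j k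
  inverts-cotrans i<j j<k (last c) = Sum.map last last (covers-split i<j j<k c)
  inverts-cotrans {j = j} i<j j<k (_∷_ {j = x} c r) with Finₚ.<-cmp x j
  ... | tri< x<j _ _  = Sum.map (c ∷_) id (inverts-cotrans x<j j<k r)
  ... | tri≈ _ refl _ = inj₂ r
  ... | tri> _ _ j<x  = Sum.map last (_∷ r) (covers-split i<j j<x c)

  covers? : ∀ i j → Dec (Covers i j)
  covers? i j = (h i <? pos j) ×-dec (pos j ≤? t i)

  -- Chains move strictly to the right, so the search from `i` ends; `d` bounds the number of
  -- positions still available.
  inverts? : ∀ i j → Dec (Inverts i j)
  inverts? i j = go n i (m≤m+n n (toℕ i))
    where
    go : ∀ d i → n ≤ d + toℕ i → Dec (Inverts i j)
    go zero    i le = ⊥-elim (<⇒≱ (toℕ<n i) le)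
    go (suc d) i le = map′ join cases (covers? i j ⊎-dec any? through?)
      where
      through? : ∀ k → Dec (Covers i k × Inverts k j)
      -- Covering is tested first because it supplies `i <ᶠ k`, which the recursive call needs for
      -- its bound.
      through? k with covers? i k
      ... | no ¬c = no (¬c ∘ proj₁)
      ... | yes c = map′ (c ,_) proj₂ (go d k
        (≤-trans le (≤-trans (≤-reflexive (sym (+-suc d (toℕ i)))) (+-monoʳ-≤ d (inverts-< (last c))))))
      join : Covers i j ⊎ ∃ (λ k → Covers i k × Inverts k j) → Inverts i j
      join (inj₁ c)           = last c
      join (inj₂ (k , c , r)) = c ∷ r
      cases : Inverts i j → Covers i j ⊎ ∃ (λ k → Covers i k × Inverts k j)
      cases (last c) = inj₁ c
      cases (c ∷ r)  = inj₂ (_ , c , r)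

  -- The order in which the permutation to be built takes its values.
  _≺_ : Fin n → Fin n → Set
  i ≺ j = (i <ᶠ j × ¬ Inverts i j) ⊎ Inverts j i

  _≺?_ : ∀ i j → Dec (i ≺ j)
  i ≺? j = ((i Finₚ.<? j) ×-dec ¬? (inverts? i j)) ⊎-dec inverts? j i

  ≺-irrefl : ∀ {i} → ¬ (i ≺ i)
  ≺-irrefl (inj₁ (lt , _)) = <-irrefl refl lt
  ≺-irrefl (inj₂ r)        = <-irrefl refl (inverts-< r)

  ≺-total : ∀ {i j} → i ≢ j → i ≺ j ⊎ j ≺ i
  ≺-total {i} {j} i≢j with Finₚ.<-cmp i j | inverts? i j | inverts? j i
  ... | tri≈ _ e _   | _     | _     = ⊥-elim (i≢j e)
  ... | tri< _ _ _   | yes r | _     = inj₂ (inj₂ r)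
  ... | tri< lt _ _  | no ¬r | _     = inj₁ (inj₁ (lt , ¬r))
  ... | tri> _ _ _   | _     | yes r = inj₁ (inj₂ r)
  ... | tri> _ _ gt  | _     | no ¬r = inj₂ (inj₁ (gt , ¬r))

  ≺-trans : ∀ {i j k} → i ≺ j → j ≺ k → i ≺ k
  ≺-trans (inj₁ (i<j , ¬ij)) (inj₁ (j<k , ¬jk)) =
    inj₁ (<-trans i<j j<k , λ ik → [ ¬ij , ¬jk ]′ (inverts-cotrans i<j j<k ik))
  ≺-trans {i} {j} {k} (inj₁ (i<j , ¬ij)) (inj₂ kj) with Finₚ.<-cmp i k
  ... | tri< i<k _ _  = inj₁ (i<k , λ ik → ¬ij (inverts-trans ik kj))
  ... | tri≈ _ refl _ = ⊥-elim (¬ij kj)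
  ... | tri> _ _ k<i  = inj₂ ([ id , ⊥-elim ∘ ¬ij ]′ (inverts-cotrans k<i i<j kj))
  ≺-trans {i} {j} {k} (inj₂ ji) (inj₁ (j<k , ¬jk)) with Finₚ.<-cmp i k
  ... | tri< i<k _ _  = inj₁ (i<k , λ ik → ¬jk (inverts-trans ji ik))
  ... | tri≈ _ refl _ = ⊥-elim (¬jk ji)
  ... | tri> _ _ k<i  = inj₂ ([ ⊥-elim ∘ ¬jk , id ]′ (inverts-cotrans j<k k<i ji))
  ≺-trans (inj₂ ji) (inj₂ kj) = inj₂ (inverts-trans kj ji)

  private
    π,mono = rankPermutation _≺?_ ≺-irrefl ≺-trans ≺-total

    π : Permutation′ n
    π = proj₁ π,mono

    π-mono : ∀ {i j} → i ≺ j → (π ⟨$⟩ʳ i) <ᶠ (π ⟨$⟩ʳ j)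
    π-mono = proj₂ π,mono

    π-cancel : ∀ {i j} → (π ⟨$⟩ʳ i) <ᶠ (π ⟨$⟩ʳ j) → i ≺ j
    π-cancel {i} {j} lt with i Finₚ.≟ j
    ... | yes refl = ⊥-elim (<-irrefl refl lt)
    ... | no  i≢j  = [ id , (λ p → ⊥-elim (<-asym lt (π-mono p))) ]′ (≺-total i≢j)

    π-inversion : ∀ {i j} → i <ᶠ j → (π ⟨$⟩ʳ j) <ᶠ (π ⟨$⟩ʳ i) → Inverts i j
    π-inversion i<j lt with π-cancel lt
    ... | inj₁ (j<i , _) = ⊥-elim (<-asym i<j j<i)
    ... | inj₂ r         = r

  fromCode : 𝔖 α
  fromCode = record
    { perm       = π
    ; increasing = λ i j j≡ e → π-mono
        (inj₁ (≤-reflexive (sym (suc-injective j≡)) , λ r → <-irrefl (cong (s α) e) (inverts-h r)))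
    }

  fromCode-avoids : ¬ Pattern231 {α = α} fromCode
  fromCode-avoids record { i<j = i<j ; j<k = j<k ; ϱi≢ϱj = i≢j ; wi<wj = wi<wj ; wi≡wk+1 = wi≡ }
    with π-inversion (<-trans i<j j<k) (≤-reflexive (sym wi≡))
  -- If `i` covers `k` directly, it also covers `j`, which lies before `k` in a region after that of
  -- `i`; this puts the value of `j` below that of `i`.
  ... | last (lt , le) = <-asym wi<wj (π-mono (inj₂ (last
          (gap (≤∧≢⇒< (mono i<j) (i≢j ∘ regionEnd-injective α)) , ≤-trans (<⇒≤ (s≤s j<k)) le))))
  -- An intermediate position of the chain would have a value strictly between two consecutive ones.
  ... | c ∷ r = <⇒≱ (π-mono (inj₂ (last c))) (subst (_≤ _) (sym wi≡) (π-mono (inj₂ r)))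

  t-fromCode : ∀ i → Codes.t {α = α} fromCode i ≡ t i
  t-fromCode i = ≤-antisym (≮⇒≥ too-big) (≮⇒≥ too-small)
    where
    too-small : ¬ (Codes.t {α = α} fromCode i < t i)
    too-small lt with t-maximal fromCode (<-≤-trans lt (upper i))
    ... | m , m≡ , vi<vm = <-asym vi<vm (π-mono (inj₂ (last (h<next fromCode {i} m≡ , subst (_≤ t i) (sym m≡) lt))))
    too-big : ¬ (t i < Codes.t {α = α} fromCode i)
    too-big lt with index (<-≤-trans lt (t-upper fromCode i))
    ... | m , m≡ = stays ≤-refl ≤-refl
                     (π-inversion (h⇒< (inside hi<m)) (t-dominates fromCode {i} {m} hi<m (≤-trans (≤-reflexive m≡) lt)))
      where
      hi<m : h i < pos m
      hi<m = subst (h i <_) (sym m≡) (s≤s (lower i))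
      -- By `across`, every position `x` on a chain from `i` to `m` keeps `t x ≤ t i`, so none of
      -- them covers `m`, which sits just past `t i`.
      stays : ∀ {x} → h i ≤ h x → t x ≤ t i → ¬ Inverts x m
      stays hi≤hx tx≤ti (last (_ , le)) = 1+n≰n (subst (_≤ t i) m≡ (≤-trans le tx≤ti))
      stays hi≤hx tx≤ti (_∷_ {j = y} (lt , le) r) = stays (<⇒≤ hi<hy)
        (across hi<hy (≤-pred (subst (h y <_) m≡ (gap (inverts-h r))))) r
        where
        hi<hy : h i < h y
        hi<hy = ≤-<-trans hi≤hx (inside lt)

proposition6p1 : (n : ℕ) → 0 < n → (α : Composition n) →
    Σ (𝔖231 α → 𝓛 (bouncePath α)) λ Φ →
    (∀ w → proj₁ (Φ w) ≡ φ (proj₁ w)) ×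
    IsPosetIsomorphism (𝒯 α) (𝒯ν (bouncePath α)) Φ
proposition6p1 n 0<n α = Φ , (λ _ → refl) , record
  { isOrderMonomorphism = record
    { isOrderHomomorphism = record
      -- Equivalent permutations agree only pointwise, so equality of their paths is drawn from
      -- antisymmetry of the rotation order.
      { cong = λ {u} {v} u≈v → Q.antisym {Φ u} {Φ v}
          (Φ-mono u v (P.reflexive {u} {v} u≈v))
          (Φ-mono v u (P.reflexive {v} {u} (P.Eq.sym {u} {v} u≈v)))
      ; mono = λ {u} {v} → Φ-mono u v
      }
    ; injective = λ {u} {v} e → P.antisym {u} {v}
        (Φ-cancel u v (Q.reflexive {Φ u} {Φ v} e)) (Φ-cancel v u (Q.reflexive {Φ v} {Φ u} (sym e)))
    ; cancel = λ {u} {v} → Φ-cancel u v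
    }
  ; surjective = surjective
  }
  where
  module P = Poset (𝒯 α)
  module Q = Poset (𝒯ν (bouncePath α))
  h = regionEnd α
  h≤n = IsRegionEnd.bound (regionEnd-isRegionEnd α)
  open Codes {α = α} using (t; t-isCode; ≤L⇒t-≤; t-≤⇒≤L)
  open StackMachine h h≤n
  open OverPath (bouncePath α) (endpoint-bouncePath α) (rightmost-bouncePath α)

  -- The counts of the values of `t w` unfold to `f w`, so the path built by `code-completes` is
  -- `φ w` by definition.
  φ-complete : ∀ (w : 𝔖 α) → Complete (φ w) (t w)
  φ-complete w = code-completes (t-isCode w)

  Φ : 𝔖231 α → 𝓛 (bouncePath α)
  Φ (w , _) = φ w , fullRun⇒∈𝓛 (Completes.run (φ-complete w))

  Φ-mono : ∀ u v → u P.≤ v → Φ u Q.≤ Φ v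
  Φ-mono (u , _) (v , _) u≤v = code-≤⇒≤ᵣ (t-isCode v) (φ-complete u) (φ-complete v) (≤L⇒t-≤ u v u≤v)

  Φ-cancel : ∀ u v → Φ u Q.≤ Φ v → u P.≤ v
  Φ-cancel (u , av) (v , _) le = t-≤⇒≤L u v av (≤ᵣ⇒code-≤ le (φ-complete u) (φ-complete v))

  surjective : ∀ μ → ∃[ w ] (∀ {z} → z P.≈ w → proj₁ (Φ z) ≡ proj₁ μ)
  surjective (μ , μ∈) with ∈𝓛⇒complete μ∈
  ... | b , c = (fromCode , fromCode-avoids) , λ {z} z≈w →
      trans (Q.antisym {Φ z} {Φ w}
              (Φ-mono z w (P.reflexive {z} {w} z≈w))
              (Φ-mono w z (P.reflexive {w} {z} (P.Eq.sym {z} {w} z≈w))))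
            (completes-path-unique (φ-complete fromCode) c t-fromCode)
    where
    open FromCode {α = α} (complete⇒isCode c)
    w : 𝔖231 α
    w = fromCode , fromCode-avoids
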